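{- If a RiFle assignment game is non-degenerate, then the set of its stable outcomes is a compact (complete) lattice under the partial order $\ge_P$. In particular, there are a unique $P$-optimal stable outcome (the maximum under $\ge_P$) and a unique $Q$-optimal stable outcome (the minimum under $\ge_P$).
   Context: A RiFle assignment game consists of two disjoint sets of agents $P=\{p_1,\dots,p_n\}$ and $Q=\{q_1,\dots,q_n\}$, a pair of nonnegative real numbers $(\beta_{ij},\gamma_{ij})$ for every pair $(p_i,q_j)\in P\times Q$ (write $\alpha_{ij}=\beta_{ij}+\gamma_{ij}$), and a designation of every agent as rigid or flexible. Let $\mathcal R$ be the set of pairs with at least one rigid agent and $\mathcal F$ the set of pairs with both agents flexible. An outcome $(\bar u,\bar v;\mu)$ consists of a matching $\mu$ between $P$ and $Q$ (write $p_i\stackrel{\mu}{\longleftrightarrow} q_j$) and payoff vectors $\bar u,\bar v\in\mathbb R^n$. It is feasible if: (1) $u_i\ge0$, $v_j\ge0$; (2) if a rigid $p_i$ is matched to $q_j$ then $u_i=\beta_{ij}$ and, if $q_j$ is flexible, $v_j\ge\gamma_{ij}$; symmetrically for a rigid $q_j$ matched to $p_i$: $v_j=\gamma_{ij}$ and, if $p_i$ is flexible, $u_i\ge\beta_{ij}$; (3) $\sum_iu_i+\sum_jv_j=\sum_{p_i\stackrel{\mu}{\longleftrightarrow}q_j}\alpha_{ij}$. It is stable if feasible and $u_i+v_j\ge\alpha_{ij}$ for $(p_i,q_j)\in\mathcal F$ and ($u_i\ge\beta_{ij}$ or $v_j\ge\gamma_{ij}$) for $(p_i,q_j)\in\mathcal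 R$. Reservation prices are modeled by rigid dummy agents; for the following definition an agent left unmatched by a matching is regarded as matched to a rigid dummy agent (whose prescribed share for him is his reservation price). Given a coalition $C\subseteq P\cup Q$ and a matching $\mu$, the total payoff to $C$ under $\mu$ is forced if every pair matched under $\mu$ with one agent in $C$ and the other outside $C$ contains a rigid agent; the forced payoff is then $\sum_{p_i\in C,\ p_i\stackrel{\mu}{\longleftrightarrow}q_j}\beta_{ij}+\sum_{q_j\in C,\ p_i\stackrel{\mu}{\longleftrightarrow}q_j}\gamma_{ij}$. The game is non-degenerate if for any two matchings $\mu,\mu'$: whenever $C$ is a minimal coalition such that the payoff to $C$ is forced under both $\mu$ and $\mu'$, and the two forced payoffs are equal, then $\mu$ and $\mu'$ coincide on $C$. For outcomes, $(\bar u,\bar v;\mu)\ge_P(\bar u',\bar v';\mu')$ means $\bar u\ge\bar u'$ and $\bar v\le\bar v'$ componentwise. -}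

module Defs where

open import Level using (0ℓ)
open import Algebra.Bundles using (CommutativeRing)
open import Data.Bool.Base using (if_then_else_)
open import Data.Fin.Base using (Fin)
open import Data.Fin.Subset using (Subset; _∈_; _∉_; _⊆_; Nonempty)
open import Data.List.Base using (List)
open import Data.List.Relation.Unary.Any using (Any)
open import Data.Maybe.Base using (Maybe; just; maybe′)
open import Data.Nat.Base using (ℕ)
open import Data.Product.Base using (Σ; Σ-syntax; ∃-syntax; _×_; proj₁)
open import Data.Sum.Base using (_⊎_)
open import Data.Vec.Base using (lookup)
open import Data.Vec.Functional using (Vector)
open import Function.Base using (flip)
open import Function.Bundles using (_⇔_)
open import Relation.Binary.Core using (Rel)
open import Relation.Binary.Structures using (IsPartialOrder; IsTotalOrder)
open import Relation.Binary.PropositionalEquality.Core using (_≡_)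
open import Relation.Nullary.Negation.Core using (¬_)
open import Relation.Unary using (Pred; Satisfiable)
import Algebra.Properties.CommutativeMonoid.Sum as CommutativeMonoidSum
import Relation.Binary.Construct.NonStrictToStrict as NonStrictToStrict

-- Order notions for an arbitrary relation

module _ {A : Set} (_≤_ : Rel A 0ℓ) where

  IsUpperBound : Pred A 0ℓ → A → Set
  IsUpperBound S b = ∀ x → S x → x ≤ b

  IsSup : Pred A 0ℓ → A → Set
  IsSup S s = IsUpperBound S s × (∀ b → IsUpperBound S b → s ≤ b)

IsInf : {A : Set} → Rel A 0ℓ → Pred A 0ℓ → A → Set
IsInf _≤_ = IsSup (flip _≤_)

-- The empty subset is included, so the lattice is bounded (and nonempty).

record IsCompleteLattice {A : Set} (_≈_ _≤_ : Rel A 0ℓ) : Set₁ where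
  field
    isPartialOrder : IsPartialOrder _≈_ _≤_
    sup            : (S : Pred A 0ℓ) → ∃[ s ] IsSup _≤_ S s
    inf            : (S : Pred A 0ℓ) → ∃[ s ] IsInf _≤_ S s

-- The real numbers, axiomatised as a Dedekind-complete totally ordered field.
-- Under excluded middle these axioms determine ℝ up to isomorphism.

record RealField : Set₁ where
  field
    commutativeRing : CommutativeRing 0ℓ 0ℓ
  open CommutativeRing commutativeRing public
  infix 4 _≤_
  field
    _≤_          : Rel Carrier 0ℓ
    isTotalOrder : IsTotalOrder _≈_ _≤_
    +-monoʳ-≤    : ∀ x {y z} → y ≤ z → x + y ≤ x + z
    *-nonneg     : ∀ {x y} → 0# ≤ x → 0# ≤ y → 0# ≤ x * y
    0≉1          : ¬ 0# ≈ 1#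
    inverse      : ∀ x → ¬ x ≈ 0# → ∃[ y ] x * y ≈ 1#
    complete     : (S : Pred Carrier 0ℓ) → Satisfiable S →
                   ∃[ b ] IsUpperBound _≤_ S b → ∃[ s ] IsSup _≤_ S s

  open NonStrictToStrict _≈_ _≤_ public using (_<_)
  open CommutativeMonoidSum +-commutativeMonoid public using (sum)

data Temper : Set where
  rigid flexible : Temper

-- A matching may leave agents unmatched; partners are recorded from both sides.

record Matching (n : ℕ) : Set where
  field
    partnerP  : Fin n → Maybe (Fin n)
    partnerQ  : Fin n → Maybe (Fin n)
    symmetric : ∀ i j → partnerP i ≡ just j ⇔ partnerQ j ≡ just i

open Matching public

Matched : ∀ {n} → Matching n → Fin n → Fin n → Set
Matched μ i j = partnerP μ i ≡ just j

-- A coalition C ⊆ P ∪ Q, given by C ∩ P and C ∩ Q.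

record Coalition (n : ℕ) : Set where
  constructor _∪ᶜ_
  field
    inP : Subset n
    inQ : Subset n

open Coalition public

NonemptyCoalition : ∀ {n} → Coalition n → Set
NonemptyCoalition C = Nonempty (inP C) ⊎ Nonempty (inQ C)

_⊆ᶜ_ : ∀ {n} → Coalition n → Coalition n → Set
C ⊆ᶜ D = inP C ⊆ inP D × inQ C ⊆ inQ D

CoincideOn : ∀ {n} → Coalition n → Matching n → Matching n → Set
CoincideOn C μ μ′ =
    (∀ i → i ∈ inP C → partnerP μ i ≡ partnerP μ′ i)
  × (∀ j → j ∈ inQ C → partnerQ μ j ≡ partnerQ μ′ j)

record RiFleGame (R : RealField) (n : ℕ) : Set where
  open RealField R
  field
    β γ     : Fin n → Fin n → Carrier
    β≥0     : ∀ i j → 0# ≤ β i j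
    γ≥0     : ∀ i j → 0# ≤ γ i j
    temperP : Fin n → Temper
    temperQ : Fin n → Temper

  α : Fin n → Fin n → Carrier
  α i j = β i j + γ i j

  InR : Fin n → Fin n → Set
  InR i j = temperP i ≡ rigid ⊎ temperQ j ≡ rigid

  InF : Fin n → Fin n → Set
  InF i j = temperP i ≡ flexible × temperQ j ≡ flexible

module _ {R : RealField} {n : ℕ} (G : RiFleGame R n) where
  open RealField R
  open RiFleGame G

  -- Non-degeneracy

  -- A pair formed by an agent and a dummy contains a rigid agent, so unmatched
  -- agents impose no condition.

  Forced : Coalition n → Matching n → Set
  Forced C μ = ∀ i j → Matched μ i j →
    (i ∈ inP C × j ∉ inQ C) ⊎ (i ∉ inP C × j ∈ inQ C) → InR i j

  -- An unmatched agent receives his reservation price, which is 0: payoffs are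
  -- only required to be nonnegative.

  forcedPayoff : Coalition n → Matching n → Carrier
  forcedPayoff C μ =
      sum (λ i → if lookup (inP C) i
                 then maybe′ (λ j → β i j) 0# (partnerP μ i) else 0#)
    + sum (λ j → if lookup (inQ C) j
                 then maybe′ (λ i → γ i j) 0# (partnerQ μ j) else 0#)

  ForcedUnderBoth : Matching n → Matching n → Coalition n → Set
  ForcedUnderBoth μ μ′ C = Forced C μ × Forced C μ′

  -- Minimality is among nonempty coalitions, since the empty one is always
  -- forced.

  MinimalForced : Matching n → Matching n → Coalition n → Set
  MinimalForced μ μ′ C =
      NonemptyCoalition C
    × ForcedUnderBoth μ μ′ C
    × (∀ D → NonemptyCoalition D → ForcedUnderBoth μ μ′ D → D ⊆ᶜ C → C ⊆ᶜ D)

  NonDegenerate : Set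
  NonDegenerate = ∀ μ μ′ C → MinimalForced μ μ′ C →
    forcedPayoff C μ ≈ forcedPayoff C μ′ → CoincideOn C μ μ′

  -- Outcomes

  record Outcome : Set where
    field
      u v : Vector Carrier n
      μ   : Matching n

  open Outcome public

  record Feasible (x : Outcome) : Set where
    field
      u≥0    : ∀ i → 0# ≤ u x i
      v≥0    : ∀ j → 0# ≤ v x j
      rigidP : ∀ i j → Matched (μ x) i j → temperP i ≡ rigid →
               u x i ≈ β i j × (temperQ j ≡ flexible → γ i j ≤ v x j)
      rigidQ : ∀ i j → Matched (μ x) i j → temperQ j ≡ rigid →
               v x j ≈ γ i j × (temperP i ≡ flexible → β i j ≤ u x i)
      total  : sum (u x) + sum (v x)
               ≈ sum (λ i → maybe′ (λ j → α i j) 0# (partnerP (μ x) i))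

  record Stable (x : Outcome) : Set where
    field
      feasible  : Feasible x
      flexPairs : ∀ i j → InF i j → α i j ≤ u x i + v x j
      rigPairs  : ∀ i j → InR i j → β i j ≤ u x i ⊎ γ i j ≤ v x j

  StableOutcome : Set
  StableOutcome = Σ Outcome Stable

  -- Equality and order; partnerP determines the matching.

  _≈ᵒ_ : Rel Outcome 0ℓ
  x ≈ᵒ y = (∀ i → u x i ≈ u y i) × (∀ j → v x j ≈ v y j)
         × (∀ i → partnerP (μ x) i ≡ partnerP (μ y) i)

  _≥ᴾ_ : Rel Outcome 0ℓ
  x ≥ᴾ y = (∀ i → u y i ≤ u x i) × (∀ j → v x j ≤ v y j)

  _≈ˢ_ : Rel StableOutcome 0ℓ
  x ≈ˢ y = proj₁ x ≈ᵒ proj₁ y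

  _≤ˢ_ : Rel StableOutcome 0ℓ
  x ≤ˢ y = proj₁ y ≥ᴾ proj₁ x

  -- Topology: Euclidean on the payoffs, discrete on the finite set of
  -- matchings. Near ε x y says that the payoffs differ by less than ε in the
  -- maximum norm and that the matchings are equal.

  Near : Carrier → Rel Outcome 0ℓ
  Near ε x y = (∀ i → u x i < u y i + ε × u y i < u x i + ε)
             × (∀ j → v x j < v y j + ε × v y j < v x j + ε)
             × (∀ i → partnerP (μ x) i ≡ partnerP (μ y) i)

  Open : Pred Outcome 0ℓ → Set
  Open U = ∀ x → U x → ∃[ ε ] (0# < ε × (∀ y → Near ε x y → U y))

  Compact : Pred Outcome 0ℓ → Set₁
  Compact K = (I : Set) (U : I → Pred Outcome 0ℓ) → (∀ k → Open (U k)) →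
    (∀ x → K x → ∃[ k ] U k x) →
    Σ[ ks ∈ List I ] (∀ x → K x → Any (λ k → U k x) ks)

{-# OPTIONS --safe #-}
module Submission where

open import Level using (0ℓ)
open import Axiom.ExcludedMiddle using (ExcludedMiddle)
open import Data.Bool.Base using (true; false; if_then_else_)
open import Data.Fin.Base using (Fin; zero; suc)
open import Data.Fin.Properties using (any?; injective⇒≤; punchOut-injective) renaming (_≟_ to _≟ᶠ_)
open import Data.Fin.Subset using (Subset; _∈_; _∉_)
open import Data.List.Base using ([]; [_]; _++_)
open import Data.List.Relation.Unary.Any using (Any; here)
open import Data.List.Relation.Unary.Any.Properties using (++⁺ˡ; ++⁺ʳ)
open import Data.Maybe.Base using (Maybe; just; nothing; maybe′)
open import Data.Maybe.Properties using (≡-dec; just-injective)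
open import Data.Nat.Base using (ℕ; zero; suc)
open import Data.Nat.Properties using (1+n≰n)
open import Data.Product.Base using (_×_; ∃-syntax; _,_; proj₁; proj₂; swap)
open import Data.Sum.Base as Sum using (_⊎_; inj₁; inj₂)
open import Data.Unit.Base using (⊤)
open import Data.Vec.Base using (tabulate; lookup)
open import Data.Vec.Functional using (Vector; _∷_; head; tail)
open import Data.Vec.Properties using (lookup⇒[]=; []=⇒lookup; lookup∘tabulate)
open import Function.Base using (_∘_; flip)
open import Function.Bundles using (mk⇔; Equivalence)
open import Relation.Binary.Bundles using (TotalOrder)
open import Relation.Binary.Core using (Rel)
open import Relation.Binary.Definitions using (Maximum; Minimum)
open import Relation.Binary.PropositionalEquality.Core as ≡ using (_≡_; _≢_)
open import Relation.Binary.Structures using (IsPartialOrder)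
open import Relation.Nullary.Decidable.Core using (Dec; yes; no; does; decidable-stable)
open import Relation.Nullary.Negation.Core using (¬_; contradiction)
open import Relation.Unary using (Pred; Satisfiable; ∅; U; _∪_; _⊆_; _⟨×⟩_)
import Algebra.Properties.CommutativeMonoid.Sum as CommutativeMonoidSum
import Algebra.Properties.Group as GroupProperties
import Algebra.Properties.Ring as RingProperties
import Algebra.Solver.CommutativeMonoid as CommutativeMonoidSolver
import Relation.Binary.Properties.TotalOrder as TotalOrderProperties
import Relation.Binary.Reasoning.PartialOrder as PartialOrderReasoning
open import Defs

-- Compare two stable outcomes x and y, and direct the pairs of the matching of
-- x from P to Q, those of y from Q to P. The gain u x − u y of an agent in P,
-- v y − v x of an agent in Q, does not decrease along an edge between flexible
-- agents; a rigid edge leads from a positive gain to a nonnegative one.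
-- If everybody in a component of the graph of flexible edges gains 0, then the
-- payoffs forced on that minimal coalition are equal, and non-degeneracy makes
-- the matchings coincide on it. Hence from a positive gain one never arrives at
-- a negative one, and the walk is a cycle by finiteness. Taking x on these
-- cycles and y elsewhere gives the join, and the reverse choice the meet.
--
-- Existence: for ε > 0 call an outcome simple if every matched agent in P has
-- no objection worth more than ε. If a simple outcome has a total payoff of Q
-- within ε of the supremum, then no free agent in P objects either, since his
-- best proposal would raise that total by ε. A cluster point for ε → 0 is
-- stable.
--
-- Compactness arguments are phrased with ideals of "small" sets: if every
-- point has a small neighbourhood, then the bounded outcomes form a small set.
-- This gives compactness, cluster points, and suprema of directed sets.

-- Arithmetic and finite sums in the real field.

module OrderedField (em : ExcludedMiddle 0ℓ) (R : RealField) where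

  open RealField R hiding (zero)

  ≤-totalOrder : TotalOrder 0ℓ 0ℓ 0ℓ
  ≤-totalOrder = record { isTotalOrder = isTotalOrder }

  open TotalOrder ≤-totalOrder public
    using (poset; total; antisym)
    renaming (refl to ≤-refl; reflexive to ≤-reflexive; trans to ≤-trans)
  open TotalOrderProperties ≤-totalOrder public using (≰⇒>; <⇒≱; <-irrefl; <-trans)
  open CommutativeMonoidSolver +-commutativeMonoid public using (solve; _⊕_; _⊜_)
  private
    module Gr = GroupProperties +-group
    module Rg = RingProperties ring
    module PO = PartialOrderReasoning poset

  ≮⇒≥ : ∀ {x y} → ¬ x < y → y ≤ x
  ≮⇒≥ x≮y = decidable-stable em λ y≰x → x≮y (≰⇒> y≰x)

  <-≤-trans : ∀ {x y z} → x < y → y ≤ z → x < z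
  <-≤-trans x<y y≤z = PO.begin-strict _ PO.<⟨ x<y ⟩ _ PO.≤⟨ y≤z ⟩ _ PO.∎

  ≤-<-trans : ∀ {x y z} → x ≤ y → y < z → x < z
  ≤-<-trans x≤y y<z = PO.begin-strict _ PO.≤⟨ x≤y ⟩ _ PO.<⟨ y<z ⟩ _ PO.∎

  +-mono-≤ : ∀ {a b c d} → a ≤ b → c ≤ d → a + c ≤ b + d
  +-mono-≤ {a} {b} {c} {d} a≤b c≤d = PO.begin
    a + c  PO.≤⟨ +-monoʳ-≤ a c≤d ⟩
    a + d  PO.≈⟨ +-comm a d ⟩
    d + a  PO.≤⟨ +-monoʳ-≤ d a≤b ⟩
    d + b  PO.≈⟨ +-comm d b ⟩
    b + d  PO.∎

  +-cancelʳ-≤ : ∀ {x y} z → x + z ≤ y + z → x ≤ y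
  +-cancelʳ-≤ {x} {y} z le = PO.begin
    x            PO.≈⟨ Gr.//-rightDividesʳ z x ⟨
    x + z - z    PO.≤⟨ +-mono-≤ le ≤-refl ⟩
    y + z - z    PO.≈⟨ Gr.//-rightDividesʳ z y ⟩
    y            PO.∎

  -- The form in which an inequality is derived from others without
  -- subtraction: the equation is then an identity of commutative monoids.

  linear-≤ : ∀ {a b x y} → a ≤ b → x + b ≈ y + a → x ≤ y
  linear-≤ {a} {b} {x} {y} a≤b eq = +-cancelʳ-≤ b (PO.begin
    x + b  PO.≈⟨ eq ⟩
    y + a  PO.≤⟨ +-monoʳ-≤ y a≤b ⟩
    y + b  PO.∎)

  linear-< : ∀ {a b x y} → a < b → x + b ≈ y + a → x < y
  linear-< {a} {b} {x} {y} a<b eq = linear-≤ (proj₁ a<b) eq , λ x≈y →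
    proj₂ a<b (sym (Gr.∙-cancelˡ y b a (trans (+-congʳ (sym x≈y)) eq)))

  +-mono-<-≤ : ∀ {a b c d} → a < b → c ≤ d → a + c < b + d
  +-mono-<-≤ {a} {b} {c} {d} a<b c≤d = <-≤-trans
    (linear-< a<b (solve 3 (λ a b c → (a ⊕ c) ⊕ b ⊜ (b ⊕ c) ⊕ a) refl a b c))
    (+-monoʳ-≤ b c≤d)

  x<x+ε : ∀ {x ε} → 0# < ε → x < x + ε
  x<x+ε {x} {ε} 0<ε = linear-< 0<ε (sym (+-identityʳ (x + ε)))

  x≤x+y : ∀ {x y} → 0# ≤ y → x ≤ x + y
  x≤x+y {x} {y} 0≤y = linear-≤ 0≤y (sym (+-identityʳ (x + y)))

  difference : ∀ {a b} → a < b → ∃[ ε ] (0# < ε × a + ε ≈ b)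
  difference {a} {b} a<b = b - a , linear-< a<b
      (trans (+-identityˡ b) (sym (Gr.//-rightDividesˡ a b)))
    , trans (+-comm a (b - a)) (Gr.//-rightDividesˡ a b)

  x≤0⇒0≤-x : ∀ {x} → x ≤ 0# → 0# ≤ - x
  x≤0⇒0≤-x {x} x≤0 = linear-≤ x≤0 (trans (+-identityˡ 0#) (sym (-‿inverseˡ x)))

  0<1 : 0# < 1#
  0<1 = 0≤1 , 0≉1
    where
    0≤1 : 0# ≤ 1#
    0≤1 with total 0# 1#
    ... | inj₁ 0≤1 = 0≤1
    ... | inj₂ 1≤0 = ≤-trans (*-nonneg (x≤0⇒0≤-x 1≤0) (x≤0⇒0≤-x 1≤0)) (≤-reflexive
      (trans (Rg.-1*x≈-x (- 1#)) (Gr.⁻¹-involutive 1#)))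

  halve : ∀ {ε} → 0# < ε → ∃[ δ ] (0# < δ × δ + δ ≈ ε)
  halve {ε} (0≤ε , 0≉ε) = δ , (*-nonneg 0≤h 0≤ε , λ 0≈δ →
      0≉ε (trans (sym (+-identityˡ 0#)) (trans (+-cong 0≈δ 0≈δ) δ+δ≈ε))) , δ+δ≈ε
    where
    0<2 : 0# < 1# + 1#
    0<2 = <-trans 0<1 (x<x+ε 0<1)
    h = proj₁ (inverse (1# + 1#) (proj₂ 0<2 ∘ sym))
    2h≈1 = proj₂ (inverse (1# + 1#) (proj₂ 0<2 ∘ sym))
    h+h≈1 : h + h ≈ 1#
    h+h≈1 = trans (sym (trans (distribʳ h 1# 1#) (+-cong (*-identityˡ h) (*-identityˡ h)))) 2h≈1
    0≤h : 0# ≤ h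
    0≤h with total 0# h
    ... | inj₁ 0≤h = 0≤h
    ... | inj₂ h≤0 = contradiction (PO.begin
      1#       PO.≈⟨ h+h≈1 ⟨
      h + h    PO.≤⟨ +-mono-≤ h≤0 h≤0 ⟩
      0# + 0#  PO.≈⟨ +-identityˡ 0# ⟩
      0#       PO.∎) (<⇒≱ 0<1)
    δ = h * ε
    δ+δ≈ε : δ + δ ≈ ε
    δ+δ≈ε = trans (sym (distribʳ ε h h)) (trans (*-congʳ h+h≈1) (*-identityˡ ε))

  quarter : ∀ {ε} → 0# < ε → ∃[ δ ] (0# < δ × (δ + δ) + (δ + δ) ≈ ε)
  quarter 0<ε with halve 0<ε
  ... | δ , 0<δ , δδ with halve 0<δ
  ... | η , 0<η , ηη = η , 0<η , trans (+-cong ηη ηη) δδ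

  minPositive : ∀ {ε δ} → 0# < ε → 0# < δ → ∃[ η ] (0# < η × η ≤ ε × η ≤ δ)
  minPositive {ε} {δ} 0<ε 0<δ with total ε δ
  ... | inj₁ ε≤δ = ε , 0<ε , ≤-refl , ε≤δ
  ... | inj₂ δ≤ε = δ , 0<δ , δ≤ε , ≤-refl

  -- Four ε are a common allowance for all limits taken later, where each of two payoffs may be off
  -- by ε and a condition may be relaxed by ε. The witness is an eighth of the difference of `a` and
  -- `b`.
  gap : ∀ {a b} → ¬ a ≤ b → ∃[ ε ] (0# < ε × ¬ a ≤ b + ((ε + ε) + (ε + ε)))
  gap {a} {b} a≰b with difference (≰⇒> a≰b)
  ... | δ , 0<δ , b+δ≈a with quarter 0<δ
  ... | η , 0<η , 4η≈δ with halve 0<η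
  ... | ε , 0<ε , 2ε≈η = ε , 0<ε , λ a≤b+4ε → <⇒≱ 0<η+η (linear-≤ a≤b+4ε (begin
    (η + η) + (b + ((ε + ε) + (ε + ε)))  ≈⟨ +-congˡ (+-congˡ (+-cong 2ε≈η 2ε≈η)) ⟩
    (η + η) + (b + (η + η))              ≈⟨ solve 2 (λ η b → (η ⊕ η) ⊕ (b ⊕ (η ⊕ η)) ⊜ b ⊕ ((η ⊕ η) ⊕ (η ⊕ η))) refl η b ⟩
    b + ((η + η) + (η + η))              ≈⟨ +-congˡ 4η≈δ ⟩
    b + δ                                ≈⟨ b+δ≈a ⟩
    a                                    ≈⟨ +-identityˡ a ⟨
    0# + a                               ∎))
    where
    open import Relation.Binary.Reasoning.Setoid setoid
    0<η+η : 0# < η + η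
    0<η+η = <-trans 0<η (x<x+ε 0<η)

  limit : ∀ {a b} → (∀ {ε} → 0# < ε → a ≤ b + ((ε + ε) + (ε + ε))) → a ≤ b
  limit h = decidable-stable em λ a≰b → let ε , 0<ε , bad = gap a≰b in bad (h 0<ε)

  -- Otherwise `s - ε` would be a smaller upper bound.
  sup-approached : ∀ {S s ε} → IsSup _≤_ S s → 0# < ε → ∃[ t ] (S t × s < t + ε)
  sup-approached {S} {s} {ε} (_ , least) 0<ε with em {∃[ t ] (S t × s < t + ε)}
  ... | yes p = p
  ... | no ¬p = contradiction
      (least (s - ε) λ t t∈S → linear-≤ (≮⇒≥ λ s<t+ε → ¬p (t , t∈S , s<t+ε)) (trans (+-congˡ s≈s-ε+ε)
        (solve 3 (λ t d e → t ⊕ (d ⊕ e) ⊜ d ⊕ (t ⊕ e)) refl t (s - ε) ε)))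
      (<⇒≱ (linear-< 0<ε (trans (sym s≈s-ε+ε) (sym (+-identityʳ s)))))
    where
    s≈s-ε+ε : s ≈ s - ε + ε
    s≈s-ε+ε = sym (Gr.//-rightDividesˡ ε s)

  sum-mono-≤ : ∀ {n} {s t : Vector Carrier n} → (∀ i → s i ≤ t i) → sum s ≤ sum t
  sum-mono-≤ {zero}  s≤t = ≤-refl
  sum-mono-≤ {suc n} s≤t = +-mono-≤ (s≤t zero) (sum-mono-≤ (s≤t ∘ suc))

  -- A strict inequality in one term could not be made up for by the others. In this way a single
  -- equation between totals yields one equation for each term.
  sum-tight : ∀ {n} {s t : Vector Carrier n} → (∀ i → s i ≤ t i) → sum t ≤ sum s →
              ∀ i → s i ≈ t i
  sum-tight {suc n} {s} {t} s≤t Σt≤Σs zero = antisym (s≤t zero) (linear-≤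
    (≤-trans Σt≤Σs (+-monoʳ-≤ (s zero) (sum-mono-≤ (s≤t ∘ suc))))
    (solve 3 (λ a b c → b ⊕ (a ⊕ c) ⊜ a ⊕ (b ⊕ c)) refl (s zero) (t zero) (sum (t ∘ suc))))
  sum-tight {suc n} {s} {t} s≤t Σt≤Σs (suc i) = sum-tight (s≤t ∘ suc) (linear-≤
    (≤-trans Σt≤Σs (+-mono-≤ (s≤t zero) ≤-refl))
    (solve 3 (λ b c d → d ⊕ (b ⊕ c) ⊜ c ⊕ (b ⊕ d)) refl (t zero) (sum (s ∘ suc)) (sum (t ∘ suc)))) i

  sum-zero : ∀ {n} {t : Vector Carrier n} → (∀ i → t i ≈ 0#) → sum t ≈ 0#
  sum-zero {zero}  t≈0 = refl
  sum-zero {suc n} t≈0 = trans (+-cong (t≈0 zero) (sum-zero (t≈0 ∘ suc))) (+-identityˡ 0#)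

  sum-single : ∀ {n} {t : Vector Carrier n} i → (∀ k → k ≢ i → t k ≈ 0#) → sum t ≈ t i
  sum-single zero    t≈0 = trans (+-congˡ (sum-zero (λ k → t≈0 (suc k) λ ()))) (+-identityʳ _)
  sum-single (suc i) t≈0 = trans
    (+-cong (t≈0 zero λ ()) (sum-single i λ k k≢i → t≈0 (suc k) λ { ≡.refl → k≢i ≡.refl })) (+-identityˡ _)

  term≤sum : ∀ {n} {t : Vector Carrier n} → (∀ i → 0# ≤ t i) → ∀ i → t i ≤ sum t
  term≤sum {suc n} {t} 0≤t zero    = x≤x+y (≤-trans (≤-reflexive (sym (sum-zero {n} λ _ → refl)))
    (sum-mono-≤ (0≤t ∘ suc)))
  term≤sum {suc n} {t} 0≤t (suc i) = ≤-trans (term≤sum (0≤t ∘ suc) i)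
    (≤-trans (x≤x+y (0≤t zero)) (≤-reflexive (+-comm _ _)))

  argmax : ∀ {n} (f : Fin n → Carrier) → Fin n → ∃[ k ] (∀ i → f i ≤ f k)
  argmax {suc zero}    f _ = zero , λ { zero → ≤-refl }
  argmax {suc (suc n)} f _ with argmax (f ∘ suc) zero
  ... | k , best with total (f zero) (f (suc k))
  ...   | inj₁ ≤k = suc k , λ { zero → ≤k ; (suc i) → best i }
  ...   | inj₂ k≤ = zero , λ { zero → ≤-refl ; (suc i) → ≤-trans (best i) k≤ }

-- Ideals of small sets and compactness.

record Ideal (X : Set) : Set₁ where
  field
    Small   : Pred X 0ℓ → Set
    ⊆-small : ∀ {A B} → A ⊆ B → Small B → Small A
    ∅-small : Small ∅
    ∪-small : ∀ {A B} → Small A → Small B → Small (A ∪ B)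

  ⋃-small : ∀ {n} (A : Fin n → Pred X 0ℓ) → (∀ i → Small (A i)) → Small (λ x → ∃[ i ] A i x)
  ⋃-small {zero}  A A-small = ⊆-small (λ ()) ∅-small
  ⋃-small {suc n} A A-small = ⊆-small
    (λ { (zero , a) → inj₁ a ; (suc i , a) → inj₂ (i , a) })
    (∪-small (A-small zero) (⋃-small (A ∘ suc) (A-small ∘ suc)))

open Ideal

pullback : ∀ {X Y : Set} → (X → Y) → Ideal X → Ideal Y
pullback f 𝓘 .Small A = Small 𝓘 (A ∘ f)
pullback f 𝓘 .⊆-small A⊆B = ⊆-small 𝓘 λ {x} → A⊆B {f x}
pullback f 𝓘 .∅-small = ⊆-small 𝓘 (λ ()) (∅-small 𝓘)
pullback f 𝓘 .∪-small A B = ∪-small 𝓘 A B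

module Compactness (em : ExcludedMiddle 0ℓ) (R : RealField) where

  open RealField R hiding (zero)
  open OrderedField em R

  -- Balls indexed by their radius stand in for a metric, so that discrete spaces and products are
  -- treated alike.
  Nearness : Set → Set₁
  Nearness X = Carrier → Rel X 0ℓ

  Monotone : ∀ {X} → Nearness X → Set
  Monotone _~_ = ∀ {δ ε x y} → δ ≤ ε → (δ ~ x) y → (ε ~ x) y

  LocallySmall : ∀ {X} → Nearness X → Ideal X → Set
  LocallySmall _~_ 𝓘 = ∀ x → ∃[ ε ] (0# < ε × Small 𝓘 (ε ~ x))

  -- Compactness as an induction principle for properties that pass to subsets and finite unions.
  -- Small neighbourhoods are demanded at every point of the space, also outside `K`.
  HeineBorel : ∀ {X} → Nearness X → Pred X 0ℓ → Set₁
  HeineBorel _~_ K = ∀ 𝓘 → LocallySmall _~_ 𝓘 → Small 𝓘 K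

  -- If every point had a small neighbourhood, `hb` would make `K` small.
  clusterPoint : ∀ {X} {_~_ : Nearness X} {K} → HeineBorel _~_ K →
    ∀ 𝓘 → ¬ Small 𝓘 K → ∃[ x ] (∀ ε → 0# < ε → ¬ Small 𝓘 (ε ~ x))
  clusterPoint {X} {_~_} {K} hb 𝓘 K-large
    with em {∃[ x ] (∀ ε → 0# < ε → ¬ Small 𝓘 (ε ~ x))}
  ... | yes found = found
  ... | no  none  = contradiction (hb 𝓘 locally) K-large
    where
    locally : LocallySmall _~_ 𝓘
    locally x with em {∃[ ε ] (0# < ε × Small 𝓘 (ε ~ x))}
    ... | yes p = p
    ... | no ¬p = contradiction (x , λ _ 0<ε small → ¬p (_ , 0<ε , small)) none

  Close : Nearness Carrier
  Close ε s t = s < t + ε × t < s + ε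

  Close-mono : Monotone Close
  Close-mono δ≤ε (s<t+δ , t<s+δ) =
    <-≤-trans s<t+δ (+-monoʳ-≤ _ δ≤ε) , <-≤-trans t<s+δ (+-monoʳ-≤ _ δ≤ε)

  Interval : Carrier → Pred Carrier 0ℓ
  Interval b t = 0# ≤ t × t ≤ b

  -- Let `s` be the supremum of all `t` with `Interval t` small. A small ball around `s` and
  -- `Interval t` for some such `t` close to `s` cover `Interval (s + δ)`, which puts `s + δ` into
  -- `S`.
  interval-compact : ∀ b → HeineBorel Close (Interval b)
  interval-compact b 𝓘 locally with em {Small 𝓘 (Interval b)}
  ... | yes small = small
  ... | no  large = contradiction (s-ub (s + δ) (⊆-small 𝓘 extend (∪-small 𝓘 t∈S ball)))
                      (<⇒≱ (x<x+ε 0<δ))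
    where
    S : Pred Carrier 0ℓ
    S t = Small 𝓘 (Interval t)

    0∈S : S 0#
    0∈S = let ε , 0<ε , small = locally 0# in ⊆-small 𝓘
      (λ (0≤t , t≤0) → <-≤-trans 0<ε (≤-trans (≤-reflexive (sym (+-identityˡ ε))) (+-mono-≤ 0≤t ≤-refl))
                     , ≤-<-trans t≤0 (x<x+ε 0<ε)) small

    b-ub : IsUpperBound _≤_ S b
    b-ub t t∈S with total t b
    ... | inj₁ t≤b = t≤b
    ... | inj₂ b≤t = contradiction (⊆-small 𝓘 (λ (0≤r , r≤b) → 0≤r , ≤-trans r≤b b≤t) t∈S) large

    supremum = complete S (0# , 0∈S) (b , b-ub)
    s = proj₁ supremum
    s-ub = proj₁ (proj₂ supremum)

    ε = proj₁ (locally s)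
    0<ε = proj₁ (proj₂ (locally s))
    ball = proj₂ (proj₂ (locally s))
    -- Half of `ε` keeps `s + δ` strictly inside the ball around `s`.
    δ = proj₁ (halve 0<ε)
    0<δ = proj₁ (proj₂ (halve 0<ε))
    δ+δ≈ε = proj₂ (proj₂ (halve 0<ε))

    s+δ<s+ε : s + δ < s + ε
    s+δ<s+ε = <-≤-trans (x<x+ε 0<δ) (≤-reflexive (trans (+-assoc s δ δ) (+-congˡ δ+δ≈ε)))

    approached = sup-approached (proj₂ supremum) 0<ε
    t = proj₁ approached
    t∈S = proj₁ (proj₂ approached)
    s<t+ε = proj₂ (proj₂ approached)

    extend : Interval (s + δ) ⊆ Interval t ∪ Close ε s
    extend {r} (0≤r , r≤s+δ) with total r t
    ... | inj₁ r≤t = inj₁ (0≤r , r≤t)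
    ... | inj₂ t≤r = inj₂ (<-≤-trans s<t+ε (+-mono-≤ t≤r ≤-refl) , ≤-<-trans r≤s+δ s+δ<s+ε)

  _⊗_ : ∀ {X Y} → Nearness X → Nearness Y → Nearness (X × Y)
  (_~_ ⊗ _≋_) ε (x , y) (x′ , y′) = (ε ~ x) x′ × (ε ≋ y) y′

  -- The tube lemma, in terms of ideals.

  ⊗-compact : ∀ {X Y} {_~_ : Nearness X} {_≋_ : Nearness Y} {K L} → Monotone _~_ →
    HeineBorel _~_ K → HeineBorel _≋_ L → HeineBorel (_~_ ⊗ _≋_) (K ⟨×⟩ L)
  ⊗-compact {X} {Y} {_~_} {_≋_} {K} {L} mono hbX hbY 𝓘 locally = hbX strips λ x → hbY (tubes x) λ y →
      let ε , 0<ε , small = locally (x , y) in ε , 0<ε , ε , 0<ε , small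
    where
    strips : Ideal X
    strips .Small A = Small 𝓘 (A ⟨×⟩ L)
    strips .⊆-small A⊆B = ⊆-small 𝓘 λ (a , l) → A⊆B a , l
    strips .∅-small = ⊆-small 𝓘 (λ ()) (∅-small 𝓘)
    strips .∪-small A B = ⊆-small 𝓘 (λ { (inj₁ a , l) → inj₁ (a , l) ; (inj₂ b , l) → inj₂ (b , l) })
      (∪-small 𝓘 A B)

    -- Smallness of `L` in `tubes x` is by definition local smallness of `strips` at `x`, which is
    -- how the two compactness hypotheses are chained.
    tubes : X → Ideal Y
    tubes x .Small A = ∃[ ε ] (0# < ε × Small 𝓘 ((ε ~ x) ⟨×⟩ A))
    tubes x .⊆-small A⊆B (ε , 0<ε , B) = ε , 0<ε , ⊆-small 𝓘 (λ (n , a) → n , A⊆B a) B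
    tubes x .∅-small = 1# , 0<1 , ⊆-small 𝓘 (λ ()) (∅-small 𝓘)
    tubes x .∪-small (ε , 0<ε , A) (δ , 0<δ , B) = let η , 0<η , η≤ε , η≤δ = minPositive 0<ε 0<δ in
      η , 0<η , ⊆-small 𝓘
        (λ { (n , inj₁ a) → inj₁ (mono η≤ε n , a) ; (n , inj₂ b) → inj₂ (mono η≤δ n , b) })
        (∪-small 𝓘 A B)

  Coordinatewise : ∀ {X} → Nearness X → ∀ n → Nearness (Vector X n)
  Coordinatewise _~_ n ε f g = ∀ i → (ε ~ f i) (g i)

  vector-compact : ∀ {X} {_~_ : Nearness X} {K} → Monotone _~_ → HeineBorel _~_ K →
    ∀ n → HeineBorel (Coordinatewise _~_ n) (λ f → ∀ i → K (f i))
  vector-compact mono hb zero 𝓘 locally =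
    let ε , 0<ε , small = locally (λ ()) in ⊆-small 𝓘 (λ _ ()) small
  vector-compact mono hb (suc n) 𝓘 locally = ⊆-small 𝓘 (λ k → k zero , k ∘ suc)
    (⊗-compact mono hb (vector-compact mono hb n) (pullback (λ f → head f , tail f) 𝓘) λ (x , f) →
      let ε , 0<ε , small = locally (x ∷ f) in
      ε , 0<ε , ⊆-small 𝓘 (λ { (n , ns) zero → n ; (n , ns) (suc i) → ns i }) small)

  Discrete : ∀ {X} → Nearness X
  Discrete ε = _≡_

  discrete-compact : ∀ {n} → HeineBorel {Maybe (Fin n)} Discrete U
  discrete-compact 𝓘 locally = ⊆-small 𝓘
    (λ { {nothing} _ → inj₁ ≡.refl ; {just i} _ → inj₂ (i , ≡.refl) })
    (∪-small 𝓘 (small nothing) (⋃-small 𝓘 (λ i → just i ≡_) (small ∘ just)))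
    where
    small : ∀ x → Small 𝓘 (x ≡_)
    small x = proj₂ (proj₂ (locally x))

-- Matchings as partial injections.

module _ {n : ℕ} where

  PartialInjection : (Fin n → Maybe (Fin n)) → Set
  PartialInjection f = ∀ {i i′ j} → f i ≡ just j → f i′ ≡ just j → i ≡ i′

  preimage : (Fin n → Maybe (Fin n)) → Fin n → Maybe (Fin n)
  preimage f j with any? (λ i → ≡-dec _≟ᶠ_ (f i) (just j))
  ... | yes (i , _) = just i
  ... | no  _       = nothing

  fromPartialInjection : (f : Fin n → Maybe (Fin n)) → PartialInjection f → Matching n
  fromPartialInjection f inj .partnerP = f
  fromPartialInjection f inj .partnerQ = preimage f
  fromPartialInjection f inj .symmetric i j = mk⇔ to from
    where
    to : f i ≡ just j → preimage f j ≡ just i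
    to fi≡j with any? (λ i → ≡-dec _≟ᶠ_ (f i) (just j))
    ... | yes (i′ , fi′≡j) = ≡.cong just (inj fi′≡j fi≡j)
    ... | no  none         = contradiction (i , fi≡j) none
    from : preimage f j ≡ just i → f i ≡ just j
    from eq with any? (λ i → ≡-dec _≟ᶠ_ (f i) (just j))
    from ≡.refl | yes (_ , fi≡j) = fi≡j

  matched⇒partnerQ : ∀ (μ : Matching n) {i j} → Matched μ i j → partnerQ μ j ≡ just i
  matched⇒partnerQ μ = Equivalence.to (symmetric μ _ _)

  partnerQ⇒matched : ∀ (μ : Matching n) {i j} → partnerQ μ j ≡ just i → Matched μ i j
  partnerQ⇒matched μ = Equivalence.from (symmetric μ _ _)

  partnerP-injective : (μ : Matching n) → PartialInjection (partnerP μ)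
  partnerP-injective μ ij i′j = just-injective
    (≡.trans (≡.sym (matched⇒partnerQ μ ij)) (matched⇒partnerQ μ i′j))

  unmatched-partnerQ : ∀ (μ : Matching n) {j} → (∀ i → ¬ Matched μ i j) → partnerQ μ j ≡ nothing
  unmatched-partnerQ μ {j} none with partnerQ μ j in eq
  ... | just i  = contradiction (partnerQ⇒matched μ eq) (none i)
  ... | nothing = ≡.refl

  partnerP-determines-partnerQ : (μ μ′ : Matching n) → (∀ i → partnerP μ i ≡ partnerP μ′ i) →
    ∀ j → partnerQ μ j ≡ partnerQ μ′ j
  partnerP-determines-partnerQ μ μ′ eq j with partnerQ μ j in μj | partnerQ μ′ j in μ′j
  ... | just i  | _       = ≡.trans
    (≡.sym (matched⇒partnerQ μ′ (≡.trans (≡.sym (eq i)) (partnerQ⇒matched μ μj)))) μ′j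
  ... | nothing | nothing = ≡.refl
  ... | nothing | just i  with ≡.trans (≡.sym μj) (matched⇒partnerQ μ (≡.trans (eq i) (partnerQ⇒matched μ′ μ′j)))
  ...   | ()

-- Sums along a matching.

module MatchingSums (em : ExcludedMiddle 0ℓ) (R : RealField) {n : ℕ} (μ : Matching n) where

  open RealField R hiding (zero)
  open OrderedField em R
  open CommutativeMonoidSum +-commutativeMonoid using (∑-comm; ∑-distrib-+; sum-cong-≋)
  open import Relation.Binary.Reasoning.Setoid setoid

  module _ (h : Fin n → Fin n → Carrier) where

    private
      cell : Fin n → Fin n → Carrier
      cell i j = if does (≡-dec _≟ᶠ_ (partnerP μ i) (just j)) then h i j else 0#

      cell-matched : ∀ {i j} → Matched μ i j → cell i j ≈ h i j
      cell-matched {i} {j} m with ≡-dec _≟ᶠ_ (partnerP μ i) (just j)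
      ... | yes _ = refl
      ... | no ¬m = contradiction m ¬m

      cell-unmatched : ∀ {i j} → ¬ Matched μ i j → cell i j ≈ 0#
      cell-unmatched {i} {j} ¬m with ≡-dec _≟ᶠ_ (partnerP μ i) (just j)
      ... | yes m = contradiction m ¬m
      ... | no _  = refl

      row : ∀ i {p} → partnerP μ i ≡ p → sum (cell i) ≈ maybe′ (h i) 0# p
      row i {just j}  eq = trans
        (sum-single j λ k k≢j → cell-unmatched λ m → k≢j (just-injective (≡.trans (≡.sym m) eq)))
        (cell-matched eq)
      row i {nothing} eq = sum-zero {n} λ k → cell-unmatched λ m → contradiction (≡.trans (≡.sym eq) m) λ ()

      column : ∀ j {p} → partnerQ μ j ≡ p → sum (λ i → cell i j) ≈ maybe′ (λ i → h i j) 0# p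
      column j {just i}  eq = trans
        (sum-single i λ k k≢i → cell-unmatched λ m → k≢i (partnerP-injective μ m (partnerQ⇒matched μ eq)))
        (cell-matched (partnerQ⇒matched μ eq))
      column j {nothing} eq = sum-zero {n} λ k → cell-unmatched λ m →
        contradiction (≡.trans (≡.sym eq) (matched⇒partnerQ μ m)) λ ()

    -- Double counting: the matrix `cell`, which vanishes off the matching, is summed by rows and by
    -- columns.
    sum-matched : sum (λ i → maybe′ (h i) 0# (partnerP μ i)) ≈ sum (λ j → maybe′ (λ i → h i j) 0# (partnerQ μ j))
    sum-matched = begin
      sum (λ i → maybe′ (h i) 0# (partnerP μ i))             ≈⟨ sum-cong-≋ (λ i → row i ≡.refl) ⟨
      sum (λ i → sum (cell i))                               ≈⟨ ∑-comm cell ⟩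
      sum (λ j → sum (λ i → cell i j))                       ≈⟨ sum-cong-≋ (λ j → column j ≡.refl) ⟩
      sum (λ j → maybe′ (λ i → h i j) 0# (partnerQ μ j))     ∎

  ifUnmatchedQ : Vector Carrier n → Vector Carrier n
  ifUnmatchedQ g j = maybe′ (λ _ → 0#) (g j) (partnerQ μ j)

  plusPartner : Vector Carrier n → Vector Carrier n → Vector Carrier n
  plusPartner e g i = e i + maybe′ g 0# (partnerP μ i)

  -- Each `g j` is charged to the partner of `j` if there is one; the second sum collects the rest.
  sum-pairs : ∀ e g → sum e + sum g ≈ sum (plusPartner e g) + sum (ifUnmatchedQ g)
  sum-pairs e g = begin
    sum e + sum g
      ≈⟨ +-congˡ (sum-cong-≋ cases) ⟩
    sum e + sum (λ j → maybe′ (λ _ → g j) 0# (partnerQ μ j) + ifUnmatchedQ g j)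
      ≈⟨ +-congˡ (∑-distrib-+ _ (ifUnmatchedQ g)) ⟩
    sum e + (sum (λ j → maybe′ (λ _ → g j) 0# (partnerQ μ j)) + sum (ifUnmatchedQ g))
      ≈⟨ +-congˡ (+-congʳ (sum-matched λ _ → g)) ⟨
    sum e + (sum (λ i → maybe′ g 0# (partnerP μ i)) + sum (ifUnmatchedQ g))
      ≈⟨ +-assoc _ _ _ ⟨
    (sum e + sum (λ i → maybe′ g 0# (partnerP μ i))) + sum (ifUnmatchedQ g)
      ≈⟨ +-congʳ (∑-distrib-+ e _) ⟨
    sum (plusPartner e g) + sum (ifUnmatchedQ g)
      ∎
    where
    cases : ∀ j → g j ≈ maybe′ (λ _ → g j) 0# (partnerQ μ j) + ifUnmatchedQ g j
    cases j with partnerQ μ j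
    ... | just _  = sym (+-identityʳ (g j))
    ... | nothing = sym (+-identityˡ (g j))

  sum-pairs-cong : ∀ {e g e′ g′} →
    (∀ i j → Matched μ i j → e i + g j ≈ e′ i + g′ j) →
    (∀ i → partnerP μ i ≡ nothing → e i ≈ e′ i) →
    (∀ j → partnerQ μ j ≡ nothing → g j ≈ g′ j) →
    sum e + sum g ≈ sum e′ + sum g′
  sum-pairs-cong {e} {g} {e′} {g′} pair aloneP aloneQ = begin
    sum e + sum g                                    ≈⟨ sum-pairs e g ⟩
    sum (plusPartner e g) + sum (ifUnmatchedQ g)     ≈⟨ +-cong (sum-cong-≋ onP) (sum-cong-≋ onQ) ⟩
    sum (plusPartner e′ g′) + sum (ifUnmatchedQ g′)  ≈⟨ sum-pairs e′ g′ ⟨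
    sum e′ + sum g′                                  ∎
    where
    onP : ∀ i → plusPartner e g i ≈ plusPartner e′ g′ i
    onP i with partnerP μ i in eq
    ... | just j  = pair i j eq
    ... | nothing = +-congʳ (aloneP i eq)
    onQ : ∀ j → ifUnmatchedQ g j ≈ ifUnmatchedQ g′ j
    onQ j with partnerQ μ j in eq
    ... | just _  = refl
    ... | nothing = aloneQ j eq

-- Stability as a condition on single pairs and agents.

module LocalStability (em : ExcludedMiddle 0ℓ) {R : RealField} {n : ℕ} (G : RiFleGame R n) where

  open RealField R hiding (zero)
  open OrderedField em R
  open RiFleGame G
  open Feasible
  open Stable

  rigid-or-flexible : ∀ i j → InR i j ⊎ InF i j
  rigid-or-flexible i j with temperP i | temperQ j
  ... | rigid    | _        = inj₁ (inj₁ ≡.refl)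
  ... | flexible | rigid    = inj₁ (inj₂ ≡.refl)
  ... | flexible | flexible = inj₂ (≡.refl , ≡.refl)

  not-rigid-and-flexible : ∀ {i j} → InR i j → ¬ InF i j
  not-rigid-and-flexible (inj₁ p) (p′ , _) = contradiction (≡.trans (≡.sym p) p′) λ ()
  not-rigid-and-flexible (inj₂ q) (_ , q′) = contradiction (≡.trans (≡.sym q) q′) λ ()

  -- In a stable outcome each matched pair shares exactly its own surplus, so
  -- that the global condition on the total can be checked pair by pair.

  record Settled (x : Outcome G) : Set where
    field
      nonnegP     : ∀ i → 0# ≤ u x i
      nonnegQ     : ∀ j → 0# ≤ v x j
      surplus     : ∀ i j → Matched (μ x) i j → u x i + v x j ≈ α i j
      rigidShares : ∀ i j → Matched (μ x) i j → InR i j → u x i ≈ β i j × v x j ≈ γ i j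
      unmatchedP  : ∀ i → partnerP (μ x) i ≡ nothing → u x i ≈ 0#
      unmatchedQ  : ∀ j → partnerQ (μ x) j ≡ nothing → v x j ≈ 0#

  open Settled public

  -- In a rigid pair only the side of Q is relaxed, because ε is the raise that a proposer has to
  -- grant. For ε = 0 this is the condition of stability.
  Unblocked : Carrier → Outcome G → Fin n → Fin n → Set
  Unblocked ε x i j = (InF i j → α i j ≤ (u x i + v x j) + ε)
                    × (InR i j → β i j ≤ u x i ⊎ γ i j ≤ v x j + ε)

  AlmostStable : Carrier → Outcome G → Set
  AlmostStable ε x = Settled x × (∀ i j → Unblocked ε x i j)

  -- A matched pair receives at least its surplus, by feasibility if it is rigid and by stability if
  -- it is flexible, and unmatched agents receive at least 0. Since the totals agree, all these
  -- inequalities are equalities.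
  stable⇒settled : ∀ {x} → Stable G x → Settled x
  stable⇒settled {x} s = record
    { nonnegP     = u≥0 f
    ; nonnegQ     = v≥0 f
    ; surplus     = exact
    ; rigidShares = shares
    ; unmatchedP  = aloneP
    ; unmatchedQ  = aloneQ
    }
    where
    open MatchingSums em R (μ x)
    f = feasible s
    M = Matched (μ x)

    value : Fin n → Carrier
    value i = maybe′ (α i) 0# (partnerP (μ x) i)

    rigid-≤ : ∀ i j → M i j → InR i j → β i j ≤ u x i × γ i j ≤ v x j
    rigid-≤ i j m (inj₁ p) with temperQ j in q
    ... | rigid    = ≤-reflexive (sym (proj₁ (rigidP f i j m p))) , ≤-reflexive (sym (proj₁ (rigidQ f i j m q)))
    ... | flexible = ≤-reflexive (sym (proj₁ (rigidP f i j m p))) , proj₂ (rigidP f i j m p) q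
    rigid-≤ i j m (inj₂ q) with temperP i in p
    ... | rigid    = ≤-reflexive (sym (proj₁ (rigidP f i j m p))) , ≤-reflexive (sym (proj₁ (rigidQ f i j m q)))
    ... | flexible = proj₂ (rigidQ f i j m q) p , ≤-reflexive (sym (proj₁ (rigidQ f i j m q)))

    value≤ : ∀ i → value i ≤ plusPartner (u x) (v x) i
    value≤ i with partnerP (μ x) i in eq
    ... | nothing = ≤-trans (u≥0 f i) (≤-reflexive (sym (+-identityʳ _)))
    ... | just j with rigid-or-flexible i j
    ...   | inj₁ r = let b , c = rigid-≤ i j eq r in +-mono-≤ b c
    ...   | inj₂ fl = flexPairs s i j fl

    0≤rest : ∀ j → 0# ≤ ifUnmatchedQ (v x) j
    0≤rest j with partnerQ (μ x) j
    ... | nothing = v≥0 f j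
    ... | just _  = ≤-refl

    sums : sum value ≈ sum (plusPartner (u x) (v x)) + sum (ifUnmatchedQ (v x))
    sums = trans (sym (total f)) (sum-pairs (u x) (v x))

    0≤Σrest : 0# ≤ sum (ifUnmatchedQ (v x))
    0≤Σrest = ≤-trans (≤-reflexive (sym (sum-zero {n} λ _ → refl))) (sum-mono-≤ 0≤rest)

    value≈ : ∀ i → value i ≈ plusPartner (u x) (v x) i
    value≈ = sum-tight value≤ (≤-trans (x≤x+y 0≤Σrest) (≤-reflexive (sym sums)))

    rest≈0 : ∀ j → 0# ≈ ifUnmatchedQ (v x) j
    rest≈0 = sum-tight 0≤rest (≤-trans (linear-≤ (sum-mono-≤ value≤)
      (trans (+-comm _ _) (trans (sym sums) (sym (+-identityˡ _)))))
      (≤-reflexive (sym (sum-zero {n} λ _ → refl))))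

    exact : ∀ i j → M i j → u x i + v x j ≈ α i j
    exact i j m with partnerP (μ x) i | value≈ i
    exact i j ≡.refl | just .j | eq = sym eq

    -- Neither share falls below the prescribed one and together they make `α i j`, so neither
    -- exceeds it.
    shares : ∀ i j → M i j → InR i j → u x i ≈ β i j × v x j ≈ γ i j
    shares i j m r = let b , c = rigid-≤ i j m r in
        antisym (linear-≤ c (exact i j m)) b
      , antisym (linear-≤ b (trans (+-comm _ _) (trans (exact i j m) (+-comm _ _)))) c

    aloneP : ∀ i → partnerP (μ x) i ≡ nothing → u x i ≈ 0#
    aloneP i eq with partnerP (μ x) i | value≈ i
    aloneP i ≡.refl | nothing | 0≈ = sym (trans 0≈ (+-identityʳ _))

    aloneQ : ∀ j → partnerQ (μ x) j ≡ nothing → v x j ≈ 0#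
    aloneQ j eq with partnerQ (μ x) j | rest≈0 j
    aloneQ j ≡.refl | nothing | 0≈ = sym 0≈

  stable⇒almostStable : ∀ {x ε} → 0# ≤ ε → Stable G x → AlmostStable ε x
  stable⇒almostStable 0≤ε s = stable⇒settled s , λ i j →
      (λ fl → ≤-trans (flexPairs s i j fl) (x≤x+y 0≤ε))
    , (λ r → Sum.map₂ (λ c → ≤-trans c (x≤x+y 0≤ε)) (rigPairs s i j r))

  almostStable⇒stable : ∀ {x} → AlmostStable 0# x → Stable G x
  almostStable⇒stable {x} (st , unblocked) = record
    { feasible = record
      { u≥0    = nonnegP st
      ; v≥0    = nonnegQ st
      ; rigidP = λ i j m r → let b , c = rigidShares st i j m (inj₁ r) in b , λ _ → ≤-reflexive (sym c)
      ; rigidQ = λ i j m r → let b , c = rigidShares st i j m (inj₂ r) in c , λ _ → ≤-reflexive (sym b)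
      ; total  = trans (sum-pairs-cong {g′ = λ _ → 0#} pair aloneP (unmatchedQ st))
                   (trans (+-congˡ (sum-zero {n} λ _ → refl)) (+-identityʳ _))
      }
    ; flexPairs = λ i j fl → ≤-trans (proj₁ (unblocked i j) fl) (≤-reflexive (+-identityʳ _))
    ; rigPairs  = λ i j r → Sum.map₂ (λ c → ≤-trans c (≤-reflexive (+-identityʳ _))) (proj₂ (unblocked i j) r)
    }
    where
    open MatchingSums em R (μ x)
    value : Fin n → Carrier
    value i = maybe′ (α i) 0# (partnerP (μ x) i)
    pair : ∀ i j → Matched (μ x) i j → u x i + v x j ≈ value i + 0#
    pair i j m = trans (surplus st i j m)
      (trans (reflexive (≡.cong (maybe′ (α i) 0#) (≡.sym m))) (sym (+-identityʳ _)))
    aloneP : ∀ i → partnerP (μ x) i ≡ nothing → u x i ≈ value i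
    aloneP i eq = trans (unmatchedP st i eq) (reflexive (≡.cong (maybe′ (α i) 0#) (≡.sym eq)))

  α≥0 : ∀ i j → 0# ≤ α i j
  α≥0 i j = ≤-trans (β≥0 i j) (x≤x+y (γ≥0 i j))

  -- A crude common bound on all payoffs, which confines settled outcomes to a compact box.
  bound : Carrier
  bound = sum λ i → sum (α i)

  α≤bound : ∀ i j → α i j ≤ bound
  α≤bound i j = ≤-trans (term≤sum (α≥0 i) j)
    (term≤sum (λ k → ≤-trans (α≥0 k j) (term≤sum (α≥0 k) j)) i)

  0≤bound : 0# ≤ bound
  0≤bound = ≤-trans (≤-reflexive (sym (sum-zero {n} λ _ → refl)))
    (sum-mono-≤ λ i → ≤-trans (≤-reflexive (sym (sum-zero {n} λ _ → refl))) (sum-mono-≤ (α≥0 i)))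

  u≤bound : ∀ {x} → Settled x → ∀ i → u x i ≤ bound
  u≤bound {x} st i with partnerP (μ x) i in eq
  ... | just j  = ≤-trans (x≤x+y (nonnegQ st j)) (≤-trans (≤-reflexive (surplus st i j eq)) (α≤bound i j))
  ... | nothing = ≤-trans (≤-reflexive (unmatchedP st i eq)) 0≤bound

  v≤bound : ∀ {x} → Settled x → ∀ j → v x j ≤ bound
  v≤bound {x} st j with partnerQ (μ x) j in eq
  ... | just i  = ≤-trans (x≤x+y (nonnegP st i)) (≤-trans
    (≤-reflexive (trans (+-comm _ _) (surplus st i j (partnerQ⇒matched (μ x) eq)))) (α≤bound i j))
  ... | nothing = ≤-trans (≤-reflexive (unmatchedQ st j eq)) 0≤bound

  Unblocked-mono : ∀ {x y δ ε i j} → δ ≤ ε → u x i ≤ u y i → v x j ≤ v y j →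
                   Unblocked δ x i j → Unblocked ε y i j
  Unblocked-mono δ≤ε u≤ v≤ (flex , rig) =
      (λ fl → ≤-trans (flex fl) (+-mono-≤ (+-mono-≤ u≤ v≤) δ≤ε))
    , (λ r → Sum.map (λ b → ≤-trans b u≤) (λ c → ≤-trans c (+-mono-≤ v≤ δ≤ε)) (rig r))

-- Limits of almost stable outcomes and compactness of the stable set.

module StableSpace (em : ExcludedMiddle 0ℓ) {R : RealField} {n : ℕ} (G : RiFleGame R n) where

  open RealField R hiding (zero)
  open OrderedField em R
  open Compactness em R
  open RiFleGame G
  open LocalStability em G

  private
    ≤4ε : ∀ {ε} → 0# < ε → ε ≤ (ε + ε) + (ε + ε)
    ≤4ε (0≤ε , _) = ≤-trans (x≤x+y 0≤ε) (x≤x+y (≤-trans 0≤ε (x≤x+y 0≤ε)))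

    interchange : ∀ a b c d → (a + b) + (c + d) ≈ (a + c) + (b + d)
    interchange = solve 4 (λ a b c d → (a ⊕ b) ⊕ (c ⊕ d) ⊜ (a ⊕ c) ⊕ (b ⊕ d)) refl

    widen : ∀ b c ε → (((b + ε) + (c + ε)) + ε) + ε ≈ (b + c) + ((ε + ε) + (ε + ε))
    widen = solve 3 (λ b c e → (((b ⊕ e) ⊕ (c ⊕ e)) ⊕ e) ⊕ e ⊜ (b ⊕ c) ⊕ ((e ⊕ e) ⊕ (e ⊕ e))) refl

  limit-≤ : ∀ {a c} → (∀ {ε} → 0# < ε → ∃[ b ] (Close ε a b × c ≤ b)) → c ≤ a
  limit-≤ {a} {c} h = limit bounded
    where
    bounded : ∀ {ε} → 0# < ε → c ≤ a + ((ε + ε) + (ε + ε))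
    bounded 0<ε with h 0<ε
    ... | b , (_ , b<a+ε) , c≤b = ≤-trans c≤b (≤-trans (proj₁ b<a+ε) (+-monoʳ-≤ a (≤4ε 0<ε)))

  limit-≥ : ∀ {a c} → (∀ {ε} → 0# < ε → ∃[ b ] (Close ε a b × b ≤ c)) → a ≤ c
  limit-≥ {a} {c} h = limit bounded
    where
    bounded : ∀ {ε} → 0# < ε → a ≤ c + ((ε + ε) + (ε + ε))
    bounded {ε} 0<ε with h 0<ε
    ... | b , (a<b+ε , _) , b≤c = ≤-trans (proj₁ a<b+ε) (+-mono-≤ b≤c (≤4ε 0<ε))

  limit-≈ : ∀ {a c} → (∀ {ε} → 0# < ε → ∃[ b ] (Close ε a b × b ≈ c)) → a ≈ c
  limit-≈ {a} {c} h = antisym (limit-≥ above) (limit-≤ below)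
    where
    above : ∀ {ε} → 0# < ε → ∃[ b ] (Close ε a b × b ≤ c)
    above 0<ε with h 0<ε
    ... | b , close , b≈c = b , close , ≤-reflexive b≈c
    below : ∀ {ε} → 0# < ε → ∃[ b ] (Close ε a b × c ≤ b)
    below 0<ε with h 0<ε
    ... | b , close , b≈c = b , close , ≤-reflexive (sym b≈c)

  limit-+-≤ : ∀ {a a′ c} →
    (∀ {ε} → 0# < ε → ∃[ b ] ∃[ b′ ] (Close ε a b × Close ε a′ b′ × c ≤ (b + b′) + ε)) → c ≤ a + a′
  limit-+-≤ {a} {a′} {c} h = limit bounded
    where
    bounded : ∀ {ε} → 0# < ε → c ≤ (a + a′) + ((ε + ε) + (ε + ε))
    bounded {ε} 0<ε with h 0<ε
    ... | b , b′ , (_ , b<a+ε) , (_ , b′<a′+ε) , c≤ = ≤-trans c≤ (≤-trans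
      (+-mono-≤ (+-mono-≤ (proj₁ b<a+ε) (proj₁ b′<a′+ε)) (≤-refl {ε}))
      (≤-trans (x≤x+y (proj₁ 0<ε)) (≤-reflexive (widen a a′ ε))))

  limit-+-≈ : ∀ {a a′ c} →
    (∀ {ε} → 0# < ε → ∃[ b ] ∃[ b′ ] (Close ε a b × Close ε a′ b′ × b + b′ ≈ c)) → a + a′ ≈ c
  limit-+-≈ {a} {a′} {c} h = antisym (limit bounded) (limit-+-≤ below)
    where
    bounded : ∀ {ε} → 0# < ε → a + a′ ≤ c + ((ε + ε) + (ε + ε))
    bounded {ε} 0<ε with h 0<ε
    ... | b , b′ , (a<b+ε , _) , (a′<b′+ε , _) , eq = ≤-trans (+-mono-≤ (proj₁ a<b+ε) (proj₁ a′<b′+ε))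
      (≤-trans (≤-reflexive (trans (interchange b ε b′ ε) (+-congʳ eq)))
        (+-monoʳ-≤ c (x≤x+y (≤-trans (proj₁ 0<ε) (x≤x+y (proj₁ 0<ε))))))
    below : ∀ {ε} → 0# < ε → ∃[ b ] ∃[ b′ ] (Close ε a b × Close ε a′ b′ × c ≤ (b + b′) + ε)
    below 0<ε with h 0<ε
    ... | b , b′ , close , close′ , eq =
      b , b′ , close , close′ , ≤-trans (≤-reflexive (sym eq)) (x≤x+y (proj₁ 0<ε))

  -- The approximants may alternate between the two cases. If both failed in the limit, they would
  -- fail by positive gaps, and an approximant for an ε below both gaps would satisfy neither.
  limit-⊎-≤ : ∀ {a a′ c c′} →
    (∀ {ε} → 0# < ε → ∃[ b ] ∃[ b′ ] (Close ε a b × Close ε a′ b′ × (c ≤ b ⊎ c′ ≤ b′ + ε))) →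
    c ≤ a ⊎ c′ ≤ a′
  limit-⊎-≤ {a} {a′} {c} {c′} h with em {c ≤ a} | em {c′ ≤ a′}
  ... | yes p | _     = inj₁ p
  ... | no _  | yes p = inj₂ p
  ... | no ¬p | no ¬q = contradiction (h 0<ε) impossible
    where
    δ₁ = gap ¬p
    δ₂ = gap ¬q
    η = minPositive (proj₁ (proj₂ δ₁)) (proj₁ (proj₂ δ₂))
    ε = proj₁ η
    0<ε = proj₁ (proj₂ η)
    ε≤δ₁ = proj₁ (proj₂ (proj₂ η))
    ε≤δ₂ = proj₂ (proj₂ (proj₂ η))
    impossible : ¬ (∃[ b ] ∃[ b′ ] (Close ε a b × Close ε a′ b′ × (c ≤ b ⊎ c′ ≤ b′ + ε)))
    impossible (b , b′ , (_ , b<a+ε) , _ , inj₁ c≤b) = proj₂ (proj₂ δ₁)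
      (≤-trans c≤b (≤-trans (proj₁ b<a+ε) (+-monoʳ-≤ a (≤-trans ε≤δ₁ (≤4ε (proj₁ (proj₂ δ₁)))))))
    impossible (b , b′ , _ , (_ , b′<a′+ε) , inj₂ c′≤b′+ε) = proj₂ (proj₂ δ₂)
      (≤-trans c′≤b′+ε (≤-trans (+-mono-≤ (≤-trans (proj₁ b′<a′+ε) (+-monoʳ-≤ a′ ε≤δ₂)) ε≤δ₂)
        (≤-trans (≤-reflexive (+-assoc a′ _ _)) (+-monoʳ-≤ a′ (x≤x+y (≤-trans 0≤δ₂ (x≤x+y 0≤δ₂)))))))
      where 0≤δ₂ = proj₁ (proj₁ (proj₂ δ₂))

  module _ {x : Outcome G} (approx : ∀ {ε} → 0# < ε → ∃[ y ] (Near G ε x y × AlmostStable ε y)) where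

    private
      nonnegP-limit : ∀ i → 0# ≤ u x i
      nonnegP-limit i = limit-≤ λ 0<ε → at (approx 0<ε)
        where
        at : ∀ {ε} → ∃[ y ] (Near G ε x y × AlmostStable ε y) → ∃[ b ] (Close ε (u x i) b × 0# ≤ b)
        at (y , (nu , _) , (st , _)) = u y i , nu i , nonnegP st i

      nonnegQ-limit : ∀ j → 0# ≤ v x j
      nonnegQ-limit j = limit-≤ λ 0<ε → at (approx 0<ε)
        where
        at : ∀ {ε} → ∃[ y ] (Near G ε x y × AlmostStable ε y) → ∃[ b ] (Close ε (v x j) b × 0# ≤ b)
        at (y , (_ , nv , _) , (st , _)) = v y j , nv j , nonnegQ st j

      surplus-limit : ∀ i j → Matched (μ x) i j → u x i + v x j ≈ α i j
      surplus-limit i j m = limit-+-≈ λ 0<ε → at (approx 0<ε)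
        where
        at : ∀ {ε} → ∃[ y ] (Near G ε x y × AlmostStable ε y) →
             ∃[ b ] ∃[ b′ ] (Close ε (u x i) b × Close ε (v x j) b′ × b + b′ ≈ α i j)
        at (y , (nu , nv , nμ) , (st , _)) =
          u y i , v y j , nu i , nv j , surplus st i j (≡.trans (≡.sym (nμ i)) m)

      rigidShareP-limit : ∀ i j → Matched (μ x) i j → InR i j → u x i ≈ β i j
      rigidShareP-limit i j m r = limit-≈ λ 0<ε → at (approx 0<ε)
        where
        at : ∀ {ε} → ∃[ y ] (Near G ε x y × AlmostStable ε y) → ∃[ b ] (Close ε (u x i) b × b ≈ β i j)
        at (y , (nu , _ , nμ) , (st , _)) =
          u y i , nu i , proj₁ (rigidShares st i j (≡.trans (≡.sym (nμ i)) m) r)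

      rigidShareQ-limit : ∀ i j → Matched (μ x) i j → InR i j → v x j ≈ γ i j
      rigidShareQ-limit i j m r = limit-≈ λ 0<ε → at (approx 0<ε)
        where
        at : ∀ {ε} → ∃[ y ] (Near G ε x y × AlmostStable ε y) → ∃[ b ] (Close ε (v x j) b × b ≈ γ i j)
        at (y , (_ , nv , nμ) , (st , _)) =
          v y j , nv j , proj₂ (rigidShares st i j (≡.trans (≡.sym (nμ i)) m) r)

      unmatchedP-limit : ∀ i → partnerP (μ x) i ≡ nothing → u x i ≈ 0#
      unmatchedP-limit i m = limit-≈ λ 0<ε → at (approx 0<ε)
        where
        at : ∀ {ε} → ∃[ y ] (Near G ε x y × AlmostStable ε y) → ∃[ b ] (Close ε (u x i) b × b ≈ 0#)
        at (y , (nu , _ , nμ) , (st , _)) = u y i , nu i , unmatchedP st i (≡.trans (≡.sym (nμ i)) m)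

      unmatchedQ-limit : ∀ j → partnerQ (μ x) j ≡ nothing → v x j ≈ 0#
      unmatchedQ-limit j m = limit-≈ λ 0<ε → at (approx 0<ε)
        where
        at : ∀ {ε} → ∃[ y ] (Near G ε x y × AlmostStable ε y) → ∃[ b ] (Close ε (v x j) b × b ≈ 0#)
        at (y , (_ , nv , nμ) , (st , _)) = v y j , nv j ,
          unmatchedQ st j (≡.trans (≡.sym (partnerP-determines-partnerQ (μ x) (μ y) nμ j)) m)

      flexible-limit : ∀ i j → InF i j → α i j ≤ u x i + v x j
      flexible-limit i j fl = limit-+-≤ λ 0<ε → at (approx 0<ε)
        where
        at : ∀ {ε} → ∃[ y ] (Near G ε x y × AlmostStable ε y) →
             ∃[ b ] ∃[ b′ ] (Close ε (u x i) b × Close ε (v x j) b′ × α i j ≤ (b + b′) + ε)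
        at (y , (nu , nv , _) , (_ , unblocked)) = u y i , v y j , nu i , nv j , proj₁ (unblocked i j) fl

      rigid-limit : ∀ i j → InR i j → β i j ≤ u x i ⊎ γ i j ≤ v x j
      rigid-limit i j r = limit-⊎-≤ λ 0<ε → at (approx 0<ε)
        where
        at : ∀ {ε} → ∃[ y ] (Near G ε x y × AlmostStable ε y) →
             ∃[ b ] ∃[ b′ ] (Close ε (u x i) b × Close ε (v x j) b′ × (β i j ≤ b ⊎ γ i j ≤ b′ + ε))
        at (y , (nu , nv , _) , (_ , unblocked)) = u y i , v y j , nu i , nv j , proj₂ (unblocked i j) r

    -- The same ε bounds the distance and the slack, so both vanish in the limit, while the matching
    -- stays fixed because near outcomes share it.
    stable-closed : Stable G x
    stable-closed = almostStable⇒stable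
      ( record
        { nonnegP     = nonnegP-limit
        ; nonnegQ     = nonnegQ-limit
        ; surplus     = surplus-limit
        ; rigidShares = λ i j m r → rigidShareP-limit i j m r , rigidShareQ-limit i j m r
        ; unmatchedP  = unmatchedP-limit
        ; unmatchedQ  = unmatchedQ-limit
        }
      , λ i j → (λ fl → ≤-trans (flexible-limit i j fl) (x≤x+y ≤-refl))
              , (λ r → Sum.map₂ (λ c → ≤-trans c (x≤x+y ≤-refl)) (rigid-limit i j r)))

  -- The contrapositive of `stable-closed`: the unstable outcomes form an open set, with one ε
  -- serving both as radius and as slack.
  unstable-separated : ∀ {x} → ¬ Stable G x →
    ∃[ ε ] (0# < ε × (∀ y → Near G ε x y → ¬ AlmostStable ε y))
  unstable-separated {x} unstable = decidable-stable em λ inseparable → unstable (stable-closed (near inseparable))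
    where
    near : ¬ (∃[ ε ] (0# < ε × (∀ y → Near G ε x y → ¬ AlmostStable ε y))) →
           ∀ {ε} → 0# < ε → ∃[ y ] (Near G ε x y × AlmostStable ε y)
    near inseparable {ε} 0<ε = decidable-stable em λ isolated →
      inseparable (ε , 0<ε , λ y near s → isolated (y , near , s))

  Bounded : Pred (Outcome G) 0ℓ
  Bounded x = (∀ i → Interval bound (u x i)) × (∀ j → Interval bound (v x j))

  settled⇒bounded : ∀ {x} → Settled x → Bounded x
  settled⇒bounded st = (λ i → nonnegP st i , u≤bound st i) , (λ j → nonnegQ st j , v≤bound st j)

  -- Payoffs range over a box and partner maps over a finite set, so the product and vector cases
  -- apply.
  bounded-compact : HeineBorel (Near G) Bounded
  bounded-compact 𝓘 locally = ⊆-small 𝓘 (λ (ub , vb) → ub , vb , _)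
    (⊗-compact (λ δ≤ε c i → Close-mono δ≤ε (c i)) payoffs
      (⊗-compact (λ δ≤ε c j → Close-mono δ≤ε (c j)) payoffs (vector-compact (λ _ eq → eq) discrete-compact n))
      (pullback (λ x → u x , v x , partnerP (μ x)) 𝓘) λ (p , q , f) → locally′ p q f)
    where
    payoffs : HeineBorel (Coordinatewise Close n) (λ p → ∀ i → Interval bound (p i))
    payoffs = vector-compact Close-mono (interval-compact bound) n

    locally′ : ∀ p q f → ∃[ ε ] (0# < ε × Small 𝓘 λ x →
      Coordinatewise Close n ε p (u x) × Coordinatewise Close n ε q (v x) × (∀ i → f i ≡ partnerP (μ x) i))
    locally′ p q f with em {∀ i i′ j → f i ≡ just j → f i′ ≡ just j → i ≡ i′}
    ... | yes inj = locally (record { u = p ; v = q ; μ = fromPartialInjection f (λ {i} {i′} {j} → inj i i′ j) })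
    -- A map that is not a partial injection is the partner map of no matching, so no outcome is
    -- near it.
    ... | no ¬inj = 1# , 0<1 , ⊆-small 𝓘 (λ {x} (_ , _ , eq) → contradiction
      (λ i i′ j fi fi′ → partnerP-injective (μ x) (≡.trans (≡.sym (eq i)) fi) (≡.trans (≡.sym (eq i′)) fi′))
      ¬inj) (∅-small 𝓘)

  -- Small sets are those whose stable members are covered by finitely many `U k`. One `U k` is
  -- enough around a stable outcome; around any other the empty list is, by `unstable-separated`.
  stable-compact : Compact G (Stable G)
  stable-compact I U U-open covered =
    let ks , cover = bounded-compact covers locally in
    ks , λ x s → cover x s (settled⇒bounded (stable⇒settled s))
    where
    covers : Ideal (Outcome G)
    covers .Small A = ∃[ ks ] (∀ x → Stable G x → A x → Any (λ k → U k x) ks)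
    covers .⊆-small A⊆B (ks , cover) = ks , λ x s a → cover x s (A⊆B a)
    covers .∅-small = [] , λ _ _ ()
    covers .∪-small (ks , coverA) (ls , coverB) = ks ++ ls , λ where
      x s (inj₁ a) → ++⁺ˡ (coverA x s a)
      x s (inj₂ b) → ++⁺ʳ ks (coverB x s b)

    locally : LocallySmall (Near G) covers
    locally x with em {Stable G x}
    ... | yes s = let k , k∋x = covered x s ; ε , 0<ε , ball = U-open k x k∋x in
      ε , 0<ε , [ k ] , λ y _ near → here (ball y near)
    ... | no ¬s = let ε , 0<ε , sep = unstable-separated ¬s in
      ε , 0<ε , [] , λ y s near → contradiction (stable⇒almostStable (proj₁ 0<ε) s) (sep y near)

-- Existence of a stable outcome.

module Existence (em : ExcludedMiddle 0ℓ) {R : RealField} {n : ℕ} (G : RiFleGame R n) where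

  open RealField R hiding (zero)
  open OrderedField em R
  open Compactness em R
  open RiFleGame G
  open LocalStability em G
  open StableSpace em G
  open CommutativeMonoidSum +-commutativeMonoid using (∑-distrib-+)

  Simple : Carrier → Outcome G → Set
  Simple ε x = Settled x × (∀ i j j′ → Matched (μ x) i j′ → Unblocked ε x i j)

  nobodyMatched : Outcome G
  nobodyMatched = record { u = λ _ → 0# ; v = λ _ → 0# ; μ = fromPartialInjection (λ _ → nothing) λ () }

  nobodyMatched-simple : ∀ {ε} → Simple ε nobodyMatched
  nobodyMatched-simple = record
    { nonnegP     = λ _ → ≤-refl
    ; nonnegQ     = λ _ → ≤-refl
    ; surplus     = λ _ _ ()
    ; rigidShares = λ _ _ ()
    ; unmatchedP  = λ _ _ → refl
    ; unmatchedQ  = λ _ _ → refl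
    } , λ _ _ _ ()

  -- The free i proposes to the partner that leaves him most when a flexible j
  -- has to be paid v j + ε and a rigid pair is possible only if γ i j exceeds
  -- v j + ε. The receiver's payoff then rises by at least ε.

  module Proposal {ε x} (0<ε : 0# < ε) (simple : Simple ε x)
                  {i} (free : partnerP (μ x) i ≡ nothing) {j₀} (blocking : ¬ Unblocked ε x i j₀) where

    private
      st = proj₁ simple

    offer : Fin n → Carrier
    offer j with rigid-or-flexible i j | em {γ i j ≤ v x j + ε}
    ... | inj₂ _ | _     = α i j - (v x j + ε)
    -- The value 0 encodes a refusal; it is never the best offer, because that one is positive.
    ... | inj₁ _ | yes _ = 0#
    ... | inj₁ _ | no  _ = β i j

    -- `offer j` is defined as a payoff from which on `i` has no objection with `j` worth more than
    -- ε.
    offer-bounded⇒unblocked : ∀ {w} j → offer j ≤ w →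
      (InF i j → α i j ≤ (w + v x j) + ε) × (InR i j → β i j ≤ w ⊎ γ i j ≤ v x j + ε)
    offer-bounded⇒unblocked {w} j le with rigid-or-flexible i j | em {γ i j ≤ v x j + ε}
    ... | inj₂ fl | _     = (λ _ → linear-≤ le (begin
          α i j + w                                      ≈⟨ +-congʳ (restore (α i j) (v x j + ε)) ⟩
          ((v x j + ε) + (α i j - (v x j + ε))) + w      ≈⟨ solve 4 (λ v e d w → ((v ⊕ e) ⊕ d) ⊕ w ⊜ ((w ⊕ v) ⊕ e) ⊕ d) refl (v x j) ε _ w ⟩
          ((w + v x j) + ε) + (α i j - (v x j + ε))      ∎))
        , λ r → contradiction fl (not-rigid-and-flexible r)
      where
      open import Relation.Binary.Reasoning.Setoid setoid
      restore : ∀ a b → a ≈ b + (a - b)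
      restore a b = sym (trans (+-comm b (a - b)) (trans (+-assoc a (- b) b) (trans (+-congˡ (-‿inverseˡ b)) (+-identityʳ a))))
    ... | inj₁ r | yes c = (λ fl → contradiction fl (not-rigid-and-flexible r)) , λ _ → inj₂ c
    ... | inj₁ r | no _  = (λ fl → contradiction fl (not-rigid-and-flexible r)) , λ _ → inj₁ le

    best = argmax offer j₀
    k = proj₁ best
    w = offer k

    -- If even the best offer were at most 0, the present payoff of `i` would leave no objection
    -- with `j₀`, against `blocking`.
    0<w : 0# < w
    0<w = ≰⇒> λ w≤0 → blocking (let flex , rig = offer-bounded⇒unblocked j₀ (≤-trans (proj₂ best j₀) w≤0) in
        (λ fl → ≤-trans (flex fl) (+-mono-≤ (+-mono-≤ (nonnegP st i) ≤-refl) ≤-refl))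
      , (λ r → Sum.map₁ (λ b → ≤-trans b (nonnegP st i)) (rig r)))

    deal : ∃[ p ] (w + p ≈ α i k × (InR i k → w ≈ β i k × p ≈ γ i k) × v x k + ε ≤ p)
    -- `0<w` is abstracted together with the cases, so that a refusal turns its type into 0 < 0.
    deal with rigid-or-flexible i k | em {γ i k ≤ v x k + ε} | 0<w
    ... | inj₂ fl | _      | _ = v x k + ε
      , trans (+-assoc _ _ _) (trans (+-congˡ (-‿inverseˡ _)) (+-identityʳ _))
      , (λ r → contradiction fl (not-rigid-and-flexible r)) , ≤-refl
    ... | inj₁ r  | yes c  | 0<0 = contradiction 0<0 (<-irrefl refl)
    ... | inj₁ r  | no ¬c  | _   = γ i k , refl , (λ _ → refl , refl) , proj₁ (≰⇒> ¬c)

    price = proj₁ deal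
    w+price≈α = proj₁ (proj₂ deal)
    rigid-deal = proj₁ (proj₂ (proj₂ deal))
    raise = proj₂ (proj₂ (proj₂ deal))

    v≤price : v x k ≤ price
    v≤price = ≤-trans (x≤x+y (proj₁ 0<ε)) raise

    withK? : ∀ i′ → Dec (Matched (μ x) i′ k)
    withK? i′ = ≡-dec _≟ᶠ_ (partnerP (μ x) i′) (just k)

    reassign : ∀ {A : Set} i′ → Dec (i′ ≡ i) → Dec (Matched (μ x) i′ k) → A → A → A → A
    reassign i′ (yes _) _       proposer rejected other = proposer
    reassign i′ (no _)  (yes _) proposer rejected other = rejected
    reassign i′ (no _)  (no _)  proposer rejected other = other

    u′ v′ : Vector Carrier n
    -- The former partner of `k` becomes unmatched, so he is left with 0.
    u′ i′ = reassign i′ (i′ ≟ᶠ i) (withK? i′) w 0# (u x i′)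
    v′ j = choose (j ≟ᶠ k)
      where
      choose : Dec (j ≡ k) → Carrier
      choose (yes _) = price
      choose (no _)  = v x j

    f′ : Fin n → Maybe (Fin n)
    f′ i′ = reassign i′ (i′ ≟ᶠ i) (withK? i′) (just k) nothing (partnerP (μ x) i′)

    f′-injective : PartialInjection f′
    f′-injective {a} {b} fa fb with a ≟ᶠ i | withK? a | b ≟ᶠ i | withK? b
    f′-injective fa fb | yes ≡.refl | _ | yes ≡.refl | _ = ≡.refl
    f′-injective ≡.refl fb | yes _ | _ | no _ | no ¬k = contradiction fb ¬k
    f′-injective fa ≡.refl | no _ | no ¬k | yes _ | _ = contradiction fa ¬k
    f′-injective fa fb | no _ | no _ | no _ | no _ = partnerP-injective (μ x) fa fb

    v≤v′ : ∀ j → v x j ≤ v′ j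
    v≤v′ j with j ≟ᶠ k
    ... | yes ≡.refl = v≤price
    ... | no _       = ≤-refl

    after : Outcome G
    after = record { u = u′ ; v = v′ ; μ = fromPartialInjection f′ f′-injective }

    f′-i : f′ i ≡ just k
    f′-i with i ≟ᶠ i
    ... | yes _ = ≡.refl
    ... | no ¬p = contradiction ≡.refl ¬p

    f′-kept : ∀ {i′ j} → Matched (μ x) i′ j → j ≢ k → f′ i′ ≡ just j
    f′-kept {i′} m j≢k with i′ ≟ᶠ i | withK? i′
    ... | yes ≡.refl | _     = contradiction (≡.trans (≡.sym free) m) λ ()
    ... | no _       | yes c = contradiction (just-injective (≡.trans (≡.sym m) c)) j≢k
    ... | no _       | no _  = m

    after-settled : Settled after
    after-settled = record
      { nonnegP = pos ; nonnegQ = λ j → ≤-trans (nonnegQ st j) (v≤v′ j)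
      ; surplus = exact ; rigidShares = shares ; unmatchedP = aloneP ; unmatchedQ = aloneQ }
      where
      pos : ∀ i′ → 0# ≤ u′ i′
      pos i′ with i′ ≟ᶠ i | withK? i′
      ... | yes _ | _     = proj₁ 0<w
      ... | no _  | yes _ = ≤-refl
      ... | no _  | no _  = nonnegP st i′

      exact : ∀ i′ j → f′ i′ ≡ just j → u′ i′ + v′ j ≈ α i′ j
      exact i′ j m with i′ ≟ᶠ i | withK? i′ | j ≟ᶠ k
      exact i′ j m      | yes ≡.refl | _     | yes ≡.refl = w+price≈α
      exact i′ j ≡.refl | yes _      | _     | no ¬p      = contradiction ≡.refl ¬p
      exact i′ j m      | no _       | no ¬c | yes ≡.refl = contradiction m ¬c
      exact i′ j m      | no _       | no _  | no _       = surplus st i′ j m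

      shares : ∀ i′ j → f′ i′ ≡ just j → InR i′ j → u′ i′ ≈ β i′ j × v′ j ≈ γ i′ j
      shares i′ j m r with i′ ≟ᶠ i | withK? i′ | j ≟ᶠ k
      shares i′ j m r      | yes ≡.refl | _     | yes ≡.refl = rigid-deal r
      shares i′ j ≡.refl r | yes _      | _     | no ¬p      = contradiction ≡.refl ¬p
      shares i′ j m r      | no _       | no ¬c | yes ≡.refl = contradiction m ¬c
      shares i′ j m r      | no _       | no _  | no _       = rigidShares st i′ j m r

      aloneP : ∀ i′ → f′ i′ ≡ nothing → u′ i′ ≈ 0#
      aloneP i′ m with i′ ≟ᶠ i | withK? i′
      ... | no _ | yes _ = refl
      ... | no _ | no _  = unmatchedP st i′ m

      aloneQ : ∀ j → preimage f′ j ≡ nothing → v′ j ≈ 0#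
      aloneQ j m with j ≟ᶠ k
      ... | yes ≡.refl = contradiction (≡.trans (≡.sym m) (matched⇒partnerQ (μ after) f′-i)) λ ()
      ... | no j≢k     = unmatchedQ st j (unmatched-partnerQ (μ x) λ i′ m′ →
        contradiction (≡.trans (≡.sym m) (matched⇒partnerQ (μ after) (f′-kept m′ j≢k))) λ ())

    -- The proposer holds the maximal offer, the other matched agents in P keep their payoffs, and
    -- payoffs in Q only rise. The rejected agent is free now, so he may object.
    after-simple : Simple ε after
    after-simple = after-settled , λ i′ j j′ m → lift (below i′ j j′ m)
      where
      interim : Outcome G
      interim = record { u = u′ ; v = v x ; μ = μ x }

      below : ∀ i′ j j′ → f′ i′ ≡ just j′ → Unblocked ε interim i′ j
      below i′ j j′ m with i′ ≟ᶠ i | withK? i′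
      ... | yes ≡.refl | _    = offer-bounded⇒unblocked j (proj₂ best j)
      ... | no _       | no _ = proj₂ simple i′ j j′ m

      lift : ∀ {i′ j} → Unblocked ε interim i′ j → Unblocked ε after i′ j
      lift {j = j} = Unblocked-mono {interim} {after} ≤-refl ≤-refl (v≤v′ j)

    progress : sum (v x) + ε ≤ sum v′
    progress = ≤-trans (≤-reflexive (trans (+-congˡ (sym ε-at-k)) (sym (∑-distrib-+ (v x) increment))))
        (sum-mono-≤ increment≤)
      where
      increment : Vector Carrier n
      increment j with j ≟ᶠ k
      ... | yes _ = ε
      ... | no _  = 0#
      ε-at-k : sum increment ≈ ε
      ε-at-k = trans (sum-single k zero-off) at
        where
        zero-off : ∀ j → j ≢ k → increment j ≈ 0#
        zero-off j j≢k with j ≟ᶠ k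
        ... | yes p = contradiction p j≢k
        ... | no _  = refl
        at : increment k ≈ ε
        at with k ≟ᶠ k
        ... | yes _ = refl
        ... | no ¬p = contradiction ≡.refl ¬p
      increment≤ : ∀ j → v x j + increment j ≤ v′ j
      increment≤ j with j ≟ᶠ k
      ... | yes ≡.refl = raise
      ... | no _       = ≤-reflexive (+-identityʳ _)

  -- The supremum of the total payoff of Q takes the place of a terminating sequence of proposals:
  -- one proposal made within ε of it would overshoot.
  almostStable-exists : ∀ {ε} → 0# < ε → ∃[ x ] AlmostStable ε x
  almostStable-exists {ε} 0<ε = x , st , unblocked
    where
    Income : Pred Carrier 0ℓ
    Income t = ∃[ x ] (Simple ε x × sum (v x) ≈ t)

    supremum : ∃[ s ] IsSup _≤_ Income s
    supremum = complete Income (_ , nobodyMatched , nobodyMatched-simple , refl)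
      (sum {n} (λ _ → bound) , λ t (x , (st , _) , eq) →
        ≤-trans (≤-reflexive (sym eq)) (sum-mono-≤ (v≤bound st)))

    near-supremum = sup-approached (proj₂ supremum) 0<ε
    t = proj₁ near-supremum
    x = proj₁ (proj₁ (proj₂ near-supremum))
    simple = proj₁ (proj₂ (proj₁ (proj₂ near-supremum)))
    st = proj₁ simple
    Σv≈t = proj₂ (proj₂ (proj₁ (proj₂ near-supremum)))
    s<t+ε = proj₂ (proj₂ near-supremum)

    unblocked : ∀ i j → Unblocked ε x i j
    unblocked i j with em {Unblocked ε x i j} | partnerP (μ x) i in eq
    ... | yes p | _       = p
    ... | no ¬p | just j′ = contradiction (proj₂ simple i j j′ eq) ¬p
    ... | no ¬p | nothing = contradiction
        (≤-trans (≤-trans (≤-reflexive (+-congʳ (sym Σv≈t))) progress)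
          (proj₁ (proj₂ supremum) _ (after , after-simple , refl)))
        (<⇒≱ s<t+ε)
      where open Proposal 0<ε simple eq ¬p

  -- If no outcome were stable, all of them would have neighbourhoods free of almost stable
  -- outcomes. By compactness one ε would then exclude every bounded outcome from being almost
  -- stable.
  stable-exists : ∃[ x ] Stable G x
  stable-exists = decidable-stable em impossible
    where
    avoiding : Ideal (Outcome G)
    avoiding .Small A = ∃[ ε ] (0# < ε × (∀ x → A x → ¬ AlmostStable ε x))
    avoiding .⊆-small A⊆B (ε , 0<ε , empty) = ε , 0<ε , λ x a → empty x (A⊆B a)
    avoiding .∅-small = 1# , 0<1 , λ _ ()
    avoiding .∪-small (ε , 0<ε , emptyA) (δ , 0<δ , emptyB) =
      let η , 0<η , η≤ε , η≤δ = minPositive 0<ε 0<δ in η , 0<η , λ where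
        x (inj₁ a) (st , unb) → emptyA x a (st , λ i j → Unblocked-mono {x} {x} η≤ε ≤-refl ≤-refl (unb i j))
        x (inj₂ b) (st , unb) → emptyB x b (st , λ i j → Unblocked-mono {x} {x} η≤δ ≤-refl ≤-refl (unb i j))

    impossible : ¬ ¬ (∃[ x ] Stable G x)
    impossible none = empty x (settled⇒bounded (proj₁ almost)) almost
      where
      locally : LocallySmall (Near G) avoiding
      locally x = let ε , 0<ε , separated = unstable-separated λ s → none (x , s) in
        ε , 0<ε , ε , 0<ε , separated

      avoided = bounded-compact avoiding locally
      0<ε = proj₁ (proj₂ avoided)
      empty = proj₂ (proj₂ avoided)
      x = proj₁ (almostStable-exists 0<ε)
      almost = proj₂ (almostStable-exists 0<ε)

-- Pigeonhole: punching out a missed value would inject `Fin (suc n)` into `Fin n`.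
injective⇒surjective : ∀ {n} (f : Fin n → Fin n) → (∀ {i j} → f i ≡ f j → i ≡ j) →
                       ∀ j → ∃[ i ] f i ≡ j
injective⇒surjective {suc n} f inj j with any? (λ i → f i ≟ᶠ j)
... | yes p = p
... | no ¬p = contradiction
  (injective⇒≤ λ {a} {b} eq → inj (punchOut-injective (λ e → ¬p (a , ≡.sym e)) (λ e → ¬p (b , ≡.sym e)) eq))
  1+n≰n

-- Components of flexible edges as minimal forced coalitions.

module Components (em : ExcludedMiddle 0ℓ) {R : RealField} {n : ℕ} (G : RiFleGame R n) where

  open import Relation.Binary.Construct.Closure.ReflexiveTransitive using (Star; ε; _◅_; _◅◅_; reverse)
  open RealField R hiding (zero)
  open OrderedField em R
  open RiFleGame G
  open LocalStability em G

  Agent : Set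
  Agent = Fin n ⊎ Fin n

  -- Coalitions are Boolean vectors; excluded middle turns a predicate into one.
  comprehension : Pred (Fin n) 0ℓ → Subset n
  comprehension P = tabulate λ i → does (em {P i})

  ∈⇒holds : ∀ {P : Pred (Fin n) 0ℓ} {i} → i ∈ comprehension P → P i
  ∈⇒holds {P} {i} i∈ with em {P i} | ≡.trans (≡.sym (lookup∘tabulate (λ i → does (em {P i})) i)) ([]=⇒lookup i∈)
  ... | yes p | _ = p

  holds⇒∈ : ∀ {P : Pred (Fin n) 0ℓ} {i} → P i → i ∈ comprehension P
  holds⇒∈ {P} {i} p = lookup⇒[]= i _ (≡.trans (lookup∘tabulate (λ i → does (em {P i})) i) eq)
    where
    eq : does (em {P i}) ≡ true
    eq with em {P i}
    ... | yes _ = ≡.refl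
    ... | no ¬p = contradiction p ¬p

  lookup-false⇒∉ : ∀ {S : Subset n} {i} → lookup S i ≡ false → i ∉ S
  lookup-false⇒∉ eq i∈ = contradiction (≡.trans (≡.sym eq) ([]=⇒lookup i∈)) λ ()

  _∈ᵃ_ : Agent → Coalition n → Set
  inj₁ i ∈ᵃ C = i ∈ inP C
  inj₂ j ∈ᵃ C = j ∈ inQ C

  coalitionPayoff : Coalition n → Outcome G → Carrier
  coalitionPayoff C x = sum (λ i → if lookup (inP C) i then u x i else 0#)
                      + sum (λ j → if lookup (inQ C) j then v x j else 0#)

  -- A matched pair inside `C` adds `α i j` to both sides, however it is divided. A pair that
  -- crosses the boundary of `C` contains a rigid agent, so its member in `C` receives the
  -- prescribed share.
  forcedPayoff≈ : ∀ {x C} → Settled x → Forced G C (μ x) → forcedPayoff G C (μ x) ≈ coalitionPayoff C x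
  forcedPayoff≈ {x} {C} st forced = MatchingSums.sum-pairs-cong em R (μ x) pair aloneP aloneQ
    where
    pair : ∀ i j → Matched (μ x) i j →
        (if lookup (inP C) i then maybe′ (λ j → β i j) 0# (partnerP (μ x) i) else 0#)
      + (if lookup (inQ C) j then maybe′ (λ i → γ i j) 0# (partnerQ (μ x) j) else 0#)
      ≈ (if lookup (inP C) i then u x i else 0#) + (if lookup (inQ C) j then v x j else 0#)
    pair i j m with lookup (inP C) i in p | lookup (inQ C) j in q | partnerP (μ x) i in mi | partnerQ (μ x) j in mj
    pair i j ≡.refl | true  | true  | _ | nothing = contradiction (≡.trans (≡.sym mj) (matched⇒partnerQ (μ x) mi)) λ ()
    pair i j ≡.refl | true  | true  | _ | just k
      with ≡.refl ← partnerP-injective (μ x) mi (partnerQ⇒matched (μ x) mj) = sym (surplus st i j mi)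
    pair i j ≡.refl | true  | false | _ | _ = +-congʳ (sym (proj₁ (rigidShares st i j mi
      (forced i j mi (inj₁ (lookup⇒[]= i _ p , lookup-false⇒∉ q))))))
    pair i j ≡.refl | false | true  | _ | nothing = contradiction (≡.trans (≡.sym mj) (matched⇒partnerQ (μ x) mi)) λ ()
    pair i j ≡.refl | false | true  | _ | just k
      with ≡.refl ← partnerP-injective (μ x) mi (partnerQ⇒matched (μ x) mj) =
      +-congˡ (sym (proj₂ (rigidShares st i j mi
        (forced i j mi (inj₂ (lookup-false⇒∉ p , lookup⇒[]= j _ q))))))
    pair i j ≡.refl | false | false | _ | _ = refl

    aloneP : ∀ i → partnerP (μ x) i ≡ nothing →
      (if lookup (inP C) i then maybe′ (λ j → β i j) 0# (partnerP (μ x) i) else 0#)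
      ≈ (if lookup (inP C) i then u x i else 0#)
    aloneP i m with lookup (inP C) i | partnerP (μ x) i in mi
    ... | false | _       = refl
    ... | true  | nothing = sym (unmatchedP st i mi)

    aloneQ : ∀ j → partnerQ (μ x) j ≡ nothing →
      (if lookup (inQ C) j then maybe′ (λ i → γ i j) 0# (partnerQ (μ x) j) else 0#)
      ≈ (if lookup (inQ C) j then v x j else 0#)
    aloneQ j m with lookup (inQ C) j | partnerQ (μ x) j in mj
    ... | false | _       = refl
    ... | true  | nothing = sym (unmatchedQ st j mj)

  -- With μ₁ directed from P to Q and μ₂ from Q to P, every agent has at most
  -- one successor and at most one predecessor.

  module Graph (μ₁ μ₂ : Matching n) where

    data Edge (K : Fin n → Fin n → Set) : Agent → Agent → Set where
      forth : ∀ {i j} → Matched μ₁ i j → K i j → Edge K (inj₁ i) (inj₂ j)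
      back  : ∀ {i j} → Matched μ₂ i j → K i j → Edge K (inj₂ j) (inj₁ i)

    FlexibleEdge RigidEdge Edges Link : Agent → Agent → Set
    FlexibleEdge = Edge InF
    RigidEdge    = Edge InR
    Edges a b    = RigidEdge a b ⊎ FlexibleEdge a b
    Link a b     = FlexibleEdge a b ⊎ FlexibleEdge b a

    successor-unique : ∀ {K L a b c} → Edge K a b → Edge L a c → b ≡ c
    successor-unique (forth m _) (forth m′ _) = ≡.cong inj₂ (just-injective (≡.trans (≡.sym m) m′))
    successor-unique (back m _)  (back m′ _)  = ≡.cong inj₁ (partnerP-injective μ₂ m m′)

    predecessor-unique : ∀ {K L a b c} → Edge K a c → Edge L b c → a ≡ b
    predecessor-unique (forth m _) (forth m′ _) = ≡.cong inj₁ (partnerP-injective μ₁ m m′)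
    predecessor-unique (back m _)  (back m′ _)  = ≡.cong inj₂ (just-injective (≡.trans (≡.sym m) m′))

    not-rigid-and-flexible-edge : ∀ {a b} → RigidEdge a b → ¬ FlexibleEdge a b
    not-rigid-and-flexible-edge (forth _ r) (forth _ f) = not-rigid-and-flexible r f
    not-rigid-and-flexible-edge (back _ r)  (back _ f)  = not-rigid-and-flexible r f

    Connected : Agent → Agent → Set
    Connected = Star Link

    component : Agent → Coalition n
    component a = comprehension (λ i → Connected a (inj₁ i)) ∪ᶜ comprehension (λ j → Connected a (inj₂ j))

    ∈-component⇒connected : ∀ {a} b → b ∈ᵃ component a → Connected a b
    ∈-component⇒connected (inj₁ i) = ∈⇒holds
    ∈-component⇒connected (inj₂ j) = ∈⇒holds

    connected⇒∈-component : ∀ {a} b → Connected a b → b ∈ᵃ component a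
    connected⇒∈-component (inj₁ i) = holds⇒∈
    connected⇒∈-component (inj₂ j) = holds⇒∈

    component-forced : ∀ a → ForcedUnderBoth G μ₁ μ₂ (component a)
    component-forced a = forced₁ , forced₂
      where
      extend : ∀ {b c} → Link b c → b ∈ᵃ component a → c ∈ᵃ component a
      extend {b} {c} l b∈ = connected⇒∈-component c (∈-component⇒connected b b∈ ◅◅ l ◅ ε)

      forced₁ : Forced G (component a) μ₁
      forced₁ i j m split with rigid-or-flexible i j | split
      ... | inj₁ r | _ = r
      ... | inj₂ f | inj₁ (i∈ , j∉) = contradiction (extend {inj₁ i} {inj₂ j} (inj₁ (forth m f)) i∈) j∉
      ... | inj₂ f | inj₂ (i∉ , j∈) = contradiction (extend {inj₂ j} {inj₁ i} (inj₂ (forth m f)) j∈) i∉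

      forced₂ : Forced G (component a) μ₂
      forced₂ i j m split with rigid-or-flexible i j | split
      ... | inj₁ r | _ = r
      ... | inj₂ f | inj₁ (i∈ , j∉) = contradiction (extend {inj₁ i} {inj₂ j} (inj₂ (back m f)) i∈) j∉
      ... | inj₂ f | inj₂ (i∉ , j∈) = contradiction (extend {inj₂ j} {inj₁ i} (inj₁ (back m f)) j∈) i∉

    -- A coalition forced under both matchings cuts no flexible edge, so it contains the whole
    -- component of each of its members.
    component-minimal : ∀ a → MinimalForced G μ₁ μ₂ (component a)
    component-minimal a = nonempty a , component-forced a , minimal
      where
      nonempty : ∀ a → NonemptyCoalition (component a)
      nonempty (inj₁ i) = inj₁ (i , connected⇒∈-component {inj₁ i} (inj₁ i) ε)
      nonempty (inj₂ j) = inj₂ (j , connected⇒∈-component {inj₂ j} (inj₂ j) ε)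

      module _ {D} (forced : ForcedUnderBoth G μ₁ μ₂ D) where

        edge-inside : ∀ {b c} → FlexibleEdge b c → (b ∈ᵃ D → c ∈ᵃ D) × (c ∈ᵃ D → b ∈ᵃ D)
        edge-inside (forth {i} {j} m f) with em {i ∈ inP D} | em {j ∈ inQ D}
        ... | yes i∈ | yes j∈ = (λ _ → j∈) , (λ _ → i∈)
        ... | no i∉  | no j∉  = (λ i∈ → contradiction i∈ i∉) , (λ j∈ → contradiction j∈ j∉)
        ... | yes i∈ | no j∉  = contradiction f (not-rigid-and-flexible (proj₁ forced i j m (inj₁ (i∈ , j∉))))
        ... | no i∉  | yes j∈ = contradiction f (not-rigid-and-flexible (proj₁ forced i j m (inj₂ (i∉ , j∈))))
        edge-inside (back {i} {j} m f) with em {i ∈ inP D} | em {j ∈ inQ D}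
        ... | yes i∈ | yes j∈ = (λ _ → i∈) , (λ _ → j∈)
        ... | no i∉  | no j∉  = (λ j∈ → contradiction j∈ j∉) , (λ i∈ → contradiction i∈ i∉)
        ... | yes i∈ | no j∉  = contradiction f (not-rigid-and-flexible (proj₂ forced i j m (inj₁ (i∈ , j∉))))
        ... | no i∉  | yes j∈ = contradiction f (not-rigid-and-flexible (proj₂ forced i j m (inj₂ (i∉ , j∈))))

        connected-inside : ∀ {b c} → Connected b c → b ∈ᵃ D → c ∈ᵃ D
        connected-inside ε            b∈ = b∈
        connected-inside (inj₁ e ◅ p) b∈ = connected-inside p (proj₁ (edge-inside e) b∈)
        connected-inside (inj₂ e ◅ p) b∈ = connected-inside p (proj₂ (edge-inside e) b∈)

      minimal : ∀ D → NonemptyCoalition D → ForcedUnderBoth G μ₁ μ₂ D → D ⊆ᶜ component a → component a ⊆ᶜ D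
      minimal D inhabited forced D⊆ =
          (λ {i} i∈ → connected-inside forced {a} {inj₁ i} (∈-component⇒connected (inj₁ i) i∈) (a∈ inhabited))
        , (λ {j} j∈ → connected-inside forced {a} {inj₂ j} (∈-component⇒connected (inj₂ j) j∈) (a∈ inhabited))
        where
        a∈ : NonemptyCoalition D → a ∈ᵃ D
        a∈ (inj₁ (i , i∈)) = connected-inside forced {inj₁ i}
          (reverse Sum.swap (∈-component⇒connected (inj₁ i) (proj₁ D⊆ i∈))) i∈
        a∈ (inj₂ (j , j∈)) = connected-inside forced {inj₂ j}
          (reverse Sum.swap (∈-component⇒connected (inj₂ j) (proj₂ D⊆ j∈))) j∈

-- Comparison of two stable outcomes.

module Comparison (em : ExcludedMiddle 0ℓ) {R : RealField} {n : ℕ} (G : RiFleGame R n)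
                  (nd : NonDegenerate G) {x y : Outcome G} (sx : Stable G x) (sy : Stable G y) where

  open import Relation.Binary.Construct.Closure.ReflexiveTransitive using (Star; ε; _◅_; reverse)
  open RealField R hiding (zero)
  open OrderedField em R
  open RiFleGame G
  open LocalStability em G
  open Components em G
  open Graph (μ x) (μ y)
  open CommutativeMonoidSum +-commutativeMonoid using (sum-cong-≋)
  open Stable

  private
    stx = stable⇒settled sx
    sty = stable⇒settled sy

  -- The gain of `a` is `hi a - lo a`, positive for an agent in P who prefers `x` and for one in Q
  -- who prefers `y`. Keeping the two terms apart avoids subtraction.
  hi lo : Agent → Carrier
  hi (inj₁ i) = u x i
  hi (inj₂ j) = v y j
  lo (inj₁ i) = u y i
  lo (inj₂ j) = v x j

  -- The pair shares exactly `α i j` in the outcome that supplies the edge, and at least that in the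
  -- other one by stability.
  flexible-monotone : ∀ {a b} → FlexibleEdge a b → hi a + lo b ≤ lo a + hi b
  flexible-monotone (forth {i} {j} m f) = ≤-trans (≤-reflexive (surplus stx i j m)) (flexPairs sy i j f)
  flexible-monotone (back {i} {j} m f)  = ≤-trans (≤-reflexive (trans (+-comm _ _) (surplus sty i j m)))
    (≤-trans (flexPairs sx i j f) (≤-reflexive (+-comm _ _)))

  flexible-≤ : ∀ {a b} → FlexibleEdge a b → lo a ≤ hi a → lo b ≤ hi b
  flexible-≤ {a} {b} e lo≤hi = linear-≤ (+-mono-≤ lo≤hi (flexible-monotone e))
    (solve 4 (λ la ha lb hb → lb ⊕ (ha ⊕ (la ⊕ hb)) ⊜ hb ⊕ (la ⊕ (ha ⊕ lb))) refl (lo a) (hi a) (lo b) (hi b))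

  flexible-< : ∀ {a b} → FlexibleEdge a b → lo a < hi a → lo b < hi b
  flexible-< {a} {b} e lo<hi = linear-< (+-mono-<-≤ lo<hi (flexible-monotone e))
    (solve 4 (λ la ha lb hb → lb ⊕ (ha ⊕ (la ⊕ hb)) ⊜ hb ⊕ (la ⊕ (ha ⊕ lb))) refl (lo a) (hi a) (lo b) (hi b))

  -- In the outcome that supplies the edge both agents have their prescribed shares. In the other
  -- one `a` has less than his, so stability grants `b` at least his own.
  rigid-≤ : ∀ {a b} → RigidEdge a b → lo a < hi a → lo b ≤ hi b
  rigid-≤ (forth {i} {j} m r) lo<hi with rigPairs sy i j r | rigidShares stx i j m r
  ... | inj₁ β≤u | u≈β , _   = contradiction (≤-trans (≤-reflexive u≈β) β≤u) (<⇒≱ lo<hi)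
  ... | inj₂ γ≤v | _   , v≈γ = ≤-trans (≤-reflexive v≈γ) γ≤v
  rigid-≤ (back {i} {j} m r) lo<hi with rigPairs sx i j r | rigidShares sty i j m r
  ... | inj₁ β≤u | u≈β , _   = ≤-trans (≤-reflexive u≈β) β≤u
  ... | inj₂ γ≤v | _   , v≈γ = contradiction (≤-trans (≤-reflexive v≈γ) γ≤v) (<⇒≱ lo<hi)

  has-successor : ∀ a → lo a < hi a → ∃[ b ] Edges a b
  has-successor (inj₁ i) lo<hi with partnerP (μ x) i in eq
  ... | just j  = inj₂ j , Sum.map (forth eq) (forth eq) (rigid-or-flexible i j)
  ... | nothing = contradiction (≤-trans (≤-reflexive (unmatchedP stx i eq)) (nonnegP sty i)) (<⇒≱ lo<hi)
  has-successor (inj₂ j) lo<hi with partnerQ (μ y) j in eq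
  ... | just i  = let m = partnerQ⇒matched (μ y) eq in
    inj₁ i , Sum.map (back m) (back m) (rigid-or-flexible i j)
  ... | nothing = contradiction (≤-trans (≤-reflexive (unmatchedQ sty j eq)) (nonnegQ stx j)) (<⇒≱ lo<hi)

  SamePartner : Agent → Set
  SamePartner (inj₁ i) = partnerP (μ x) i ≡ partnerP (μ y) i
  SamePartner (inj₂ j) = partnerQ (μ x) j ≡ partnerQ (μ y) j

  -- Non-degeneracy is applied here: the component of `a` is a minimal forced coalition, and its
  -- forced payoffs are the coalition payoffs, which agree if nobody in it gains or loses.
  coincide : ∀ a → (∀ {b} → Connected a b → lo b ≈ hi b) → SamePartner a
  coincide a equal = at a (connected⇒∈-component a ε)
    where
    C = component a
    forced = component-forced a

    equalP : ∀ i → (if lookup (inP C) i then u x i else 0#) ≈ (if lookup (inP C) i then u y i else 0#)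
    equalP i with lookup (inP C) i in eq
    ... | true  = sym (equal (∈-component⇒connected (inj₁ i) (lookup⇒[]= i _ eq)))
    ... | false = refl

    equalQ : ∀ j → (if lookup (inQ C) j then v x j else 0#) ≈ (if lookup (inQ C) j then v y j else 0#)
    equalQ j with lookup (inQ C) j in eq
    ... | true  = equal (∈-component⇒connected (inj₂ j) (lookup⇒[]= j _ eq))
    ... | false = refl

    coincidence : CoincideOn C (μ x) (μ y)
    coincidence = nd (μ x) (μ y) C (component-minimal a)
      (trans (forcedPayoff≈ {C = C} stx (proj₁ forced))
        (trans (+-cong (sum-cong-≋ equalP) (sum-cong-≋ equalQ))
          (sym (forcedPayoff≈ {C = C} sty (proj₂ forced)))))

    at : ∀ b → b ∈ᵃ C → SamePartner b
    at (inj₁ i) = proj₁ coincidence i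
    at (inj₂ j) = proj₂ coincidence j

  -- The rigid pair is then matched in both outcomes and receives its prescribed shares in both.
  shared-rigid : ∀ {a b} → RigidEdge a b → SamePartner b → lo a ≈ hi a
  shared-rigid (forth {i} {j} m r) same = trans
    (proj₁ (rigidShares sty i j (partnerQ⇒matched (μ y) (≡.trans (≡.sym same) (matched⇒partnerQ (μ x) m))) r))
    (sym (proj₁ (rigidShares stx i j m r)))
  shared-rigid (back {i} {j} m r) same = trans
    (proj₂ (rigidShares stx i j (≡.trans same m) r)) (sym (proj₂ (rigidShares sty i j m r)))

  -- Behind a rigid edge, the component of the endpoint is a directed path
  -- starting there.

  connected⇒ahead : ∀ {a b c} → RigidEdge a b → Connected b c → Star (flip FlexibleEdge) c b
  connected⇒ahead {a} {b} r = extend ε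
    where
    extend : ∀ {c d} → Star (flip FlexibleEdge) c b → Connected c d → Star (flip FlexibleEdge) d b
    extend q ε = q
    extend q (inj₁ e ◅ p) = extend (e ◅ q) p
    extend ε (inj₂ e ◅ p) with ≡.refl ← predecessor-unique r e = contradiction e (not-rigid-and-flexible-edge r)
    extend (e′ ◅ q) (inj₂ e ◅ p) with ≡.refl ← predecessor-unique e′ e = extend q p

  ahead-≤ : ∀ {b c} → lo b ≤ hi b → Star (flip FlexibleEdge) c b → lo c ≤ hi c
  ahead-≤ le ε       = le
  ahead-≤ le (e ◅ q) = flexible-≤ e (ahead-≤ le q)

  -- A rigid edge out of a carries information only if lo a < hi a. The path
  -- guarantees that such a strict gain is reached before the next rigid edge,
  -- which makes Favours closed under successors.

  Favours : Agent → Set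
  Favours a = lo a ≤ hi a × ∃[ c ] (Star FlexibleEdge a c × lo c < hi c)

  strict⇒favours : ∀ {a} → lo a < hi a → Favours a
  strict⇒favours lo<hi = proj₁ lo<hi , _ , ε , lo<hi

  -- Everybody in the component of `b` lies ahead of `b` and gains at least 0. If nobody gained
  -- more, the matchings would coincide at `b`, and `shared-rigid` would contradict the strict gain
  -- of `a`.
  favours-rigid : ∀ {a b} → RigidEdge a b → lo a < hi a → Favours b
  favours-rigid {a} {b} r lo<hi with em {∃[ c ] (Star FlexibleEdge b c × lo c < hi c)}
  ... | yes p = rigid-≤ r lo<hi , p
  ... | no ¬p = contradiction (shared-rigid r (coincide b equal)) (proj₂ lo<hi)
    where
    equal : ∀ {c} → Connected b c → lo c ≈ hi c
    equal {c} p = antisym (ahead-≤ (rigid-≤ r lo<hi) q) (≮⇒≥ λ c< → ¬p (c , reverse (λ e → e) q , c<))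
      where
      q = connected⇒ahead r p

  -- A strict gain at `a` itself provides a successor; otherwise the path in `Favours` begins with
  -- one.
  step : ∀ {a} → Favours a → ∃[ b ] (Edges a b × Favours b)
  step {a} (_ , _ , ε , lo<hi) with has-successor a lo<hi
  ... | b , inj₁ r = b , inj₁ r , favours-rigid r lo<hi
  ... | b , inj₂ e = b , inj₂ e , strict⇒favours (flexible-< e lo<hi)
  step (lo≤hi , c , e ◅ p , lo<hi) = _ , inj₂ e , flexible-≤ e lo≤hi , c , p , lo<hi

  favours-forward : ∀ {a b} → Edges a b → Favours a → Favours b
  favours-forward e fa with step fa
  favours-forward (inj₁ e) fa | _ , inj₁ e′ , fb with ≡.refl ← successor-unique e e′ = fb
  favours-forward (inj₁ e) fa | _ , inj₂ e′ , fb with ≡.refl ← successor-unique e e′ = fb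
  favours-forward (inj₂ e) fa | _ , inj₁ e′ , fb with ≡.refl ← successor-unique e e′ = fb
  favours-forward (inj₂ e) fa | _ , inj₂ e′ , fb with ≡.refl ← successor-unique e e′ = fb

  matched⇒edge₁ : ∀ {i j} → Matched (μ x) i j → Edges (inj₁ i) (inj₂ j)
  matched⇒edge₁ m = Sum.map (forth m) (forth m) (rigid-or-flexible _ _)

  matched⇒edge₂ : ∀ {i j} → Matched (μ y) i j → Edges (inj₂ j) (inj₁ i)
  matched⇒edge₂ m = Sum.map (back m) (back m) (rigid-or-flexible _ _)

  stepP : ∀ {i} → Favours (inj₁ i) → ∃[ j ] (Matched (μ x) i j × Favours (inj₂ j))
  stepP fi with step fi
  ... | _ , inj₁ (forth m _) , fj = _ , m , fj
  ... | _ , inj₂ (forth m _) , fj = _ , m , fj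

  stepQ : ∀ {j} → Favours (inj₂ j) → ∃[ i ] (Matched (μ y) i j × Favours (inj₁ i))
  stepQ fj with step fj
  ... | _ , inj₁ (back m _) , fi = _ , m , fi
  ... | _ , inj₂ (back m _) , fi = _ , m , fi

  -- Going two edges ahead is an injection of the finite set of favoured agents
  -- in P into itself, hence a surjection; so Favours is also closed under
  -- predecessors.

  advance : ∀ i → Dec (Favours (inj₁ i)) → Fin n
  advance i (no _)   = i
  advance i (yes fi) = proj₁ (stepQ (proj₂ (proj₂ (stepP fi))))

  advance-favours : ∀ {i} fi → Favours (inj₁ (advance i (yes fi)))
  advance-favours fi = proj₂ (proj₂ (stepQ (proj₂ (proj₂ (stepP fi)))))

  -- Fixing the agents that are not favoured extends the map to all of `Fin n`; no favoured agent
  -- lands on one of them, and two favoured agents with the same image are traced back through both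
  -- matchings.
  advance-injective : ∀ {i i′} d d′ → advance i d ≡ advance i′ d′ → i ≡ i′
  advance-injective (no _)   (no _)    eq     = eq
  advance-injective (no ¬fi) (yes fi′) ≡.refl = contradiction (advance-favours fi′) ¬fi
  advance-injective (yes fi) (no ¬fi′) ≡.refl = contradiction (advance-favours fi) ¬fi′
  advance-injective (yes fi) (yes fi′) eq with stepP fi | stepP fi′
  ... | j , m , fj | j′ , m′ , fj′ with stepQ fj | stepQ fj′
  ... | k , l , _ | k′ , l′ , _ with ≡.refl ← eq with ≡.refl ← just-injective (≡.trans (≡.sym l) l′) =
    partnerP-injective (μ x) m m′

  -- By surjectivity `k` is two edges ahead of some `i`, who is favoured because otherwise he would
  -- be fixed.
  predecessors : ∀ {k} → Favours (inj₁ k) →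
    ∃[ j ] ∃[ i ] (Matched (μ y) k j × Favours (inj₂ j) × Matched (μ x) i j × Favours (inj₁ i))
  predecessors {k} fk with injective⇒surjective (λ i → advance i em) (advance-injective em em) k
  ... | i , eq with em {Favours (inj₁ i)}
  ...   | no ¬fi with ≡.refl ← eq = contradiction fk ¬fi
  ...   | yes fi with stepP fi
  ...     | j , m , fj with stepQ fj
  ...       | _ , l , _ with ≡.refl ← eq = j , i , l , fj , m , fi

  favours-backward₂ : ∀ {i j} → Matched (μ y) i j → Favours (inj₁ i) → Favours (inj₂ j)
  favours-backward₂ m fi with predecessors fi
  ... | _ , _ , m′ , fj , _ with ≡.refl ← just-injective (≡.trans (≡.sym m) m′) = fj

  favours-backward₁ : ∀ {i j} → Matched (μ x) i j → Favours (inj₂ j) → Favours (inj₁ i)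
  favours-backward₁ m fj with stepQ fj
  ... | k , l , fk with predecessors fk
  ...   | _ , i , l′ , _ , m′ , fi
    with ≡.refl ← just-injective (≡.trans (≡.sym l) l′)
    with ≡.refl ← partnerP-injective (μ x) m m′ = fi

-- Joins, meets and completeness.

module Lattice (em : ExcludedMiddle 0ℓ) {R : RealField} {n : ℕ} (G : RiFleGame R n)
               (nd : NonDegenerate G) where

  open RealField R hiding (zero)
  open OrderedField em R
  open Compactness em R
  open RiFleGame G
  open LocalStability em G
  open StableSpace em G
  open Existence em G
  open Components em G using (Agent)

  -- Since `A` is closed under partners in both matchings, every pair of the new matching lies
  -- wholly inside or wholly outside `A`, and the conditions in `Settled` are inherited. Unblocked
  -- pairs across the boundary are a separate matter.
  module Splice {x y : Outcome G} (stx : Settled x) (sty : Settled y) (A : Agent → Set)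
      (closed₁ : ∀ {i j} → Matched (μ x) i j → (A (inj₁ i) → A (inj₂ j)) × (A (inj₂ j) → A (inj₁ i)))
      (closed₂ : ∀ {i j} → Matched (μ y) i j → (A (inj₁ i) → A (inj₂ j)) × (A (inj₂ j) → A (inj₁ i)))
    where

    select : ∀ {a} {B : Set} → Dec (A a) → B → B → B
    select (yes _) b₁ b₂ = b₁
    select (no _)  b₁ b₂ = b₂

    matching : Matching n
    matching .partnerP i = select (em {A (inj₁ i)}) (partnerP (μ x) i) (partnerP (μ y) i)
    matching .partnerQ j = select (em {A (inj₂ j)}) (partnerQ (μ x) j) (partnerQ (μ y) j)
    matching .symmetric i j with em {A (inj₁ i)} | em {A (inj₂ j)}
    ... | yes _ | yes _  = symmetric (μ x) i j
    ... | no _  | no _   = symmetric (μ y) i j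
    ... | yes a | no ¬b  = mk⇔ (λ m → contradiction (proj₁ (closed₁ m) a) ¬b)
      (λ m → contradiction (proj₁ (closed₂ (partnerQ⇒matched (μ y) m)) a) ¬b)
    ... | no ¬a | yes b  = mk⇔ (λ m → contradiction (proj₂ (closed₂ m) b) ¬a)
      (λ m → contradiction (proj₂ (closed₁ (partnerQ⇒matched (μ x) m)) b) ¬a)

    outcome : Outcome G
    outcome .u i = select (em {A (inj₁ i)}) (u x i) (u y i)
    outcome .v j = select (em {A (inj₂ j)}) (v x j) (v y j)
    outcome .μ   = matching

    settled : Settled outcome
    settled = record
      { nonnegP = posP ; nonnegQ = posQ ; surplus = exact ; rigidShares = shares
      ; unmatchedP = aloneP ; unmatchedQ = aloneQ }
      where
      posP : ∀ i → 0# ≤ u outcome i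
      posP i with em {A (inj₁ i)}
      ... | yes _ = nonnegP stx i
      ... | no _  = nonnegP sty i

      posQ : ∀ j → 0# ≤ v outcome j
      posQ j with em {A (inj₂ j)}
      ... | yes _ = nonnegQ stx j
      ... | no _  = nonnegQ sty j

      exact : ∀ i j → Matched matching i j → u outcome i + v outcome j ≈ α i j
      exact i j m with em {A (inj₁ i)} | em {A (inj₂ j)}
      ... | yes _ | yes _  = surplus stx i j m
      ... | no _  | no _   = surplus sty i j m
      ... | yes a | no ¬b  = contradiction (proj₁ (closed₁ m) a) ¬b
      ... | no ¬a | yes b  = contradiction (proj₂ (closed₂ m) b) ¬a

      shares : ∀ i j → Matched matching i j → InR i j → u outcome i ≈ β i j × v outcome j ≈ γ i j
      shares i j m r with em {A (inj₁ i)} | em {A (inj₂ j)}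
      ... | yes _ | yes _  = rigidShares stx i j m r
      ... | no _  | no _   = rigidShares sty i j m r
      ... | yes a | no ¬b  = contradiction (proj₁ (closed₁ m) a) ¬b
      ... | no ¬a | yes b  = contradiction (proj₂ (closed₂ m) b) ¬a

      aloneP : ∀ i → partnerP matching i ≡ nothing → u outcome i ≈ 0#
      aloneP i m with em {A (inj₁ i)}
      ... | yes _ = unmatchedP stx i m
      ... | no _  = unmatchedP sty i m

      aloneQ : ∀ j → partnerQ matching j ≡ nothing → v outcome j ≈ 0#
      aloneQ j m with em {A (inj₂ j)}
      ... | yes _ = unmatchedQ stx j m
      ... | no _  = unmatchedQ sty j m

    u-cases : ∀ (P : Carrier → Set) i → (A (inj₁ i) → P (u x i)) → (¬ A (inj₁ i) → P (u y i)) → P (u outcome i)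
    u-cases P i on off with em {A (inj₁ i)}
    ... | yes a = on a
    ... | no ¬a = off ¬a

    v-cases : ∀ (P : Carrier → Set) j → (A (inj₂ j) → P (v x j)) → (¬ A (inj₂ j) → P (v y j)) → P (v outcome j)
    v-cases P j on off with em {A (inj₂ j)}
    ... | yes a = on a
    ... | no ¬a = off ¬a

  StableOutcomes : Set
  StableOutcomes = StableOutcome G

  HasJoins : Rel StableOutcomes 0ℓ → Set
  HasJoins _⊑_ = ∀ x y → ∃[ z ] (x ⊑ z × y ⊑ z × (∀ b → x ⊑ b → y ⊑ b → z ⊑ b))

  module Binary (sox soy : StableOutcomes) where

    x = proj₁ sox
    y = proj₁ soy
    sx = proj₂ sox
    sy = proj₂ soy

    open Comparison em G nd {x} {y} sx sy

    lo≤hi : ∀ {a} → Favours a → lo a ≤ hi a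
    lo≤hi = proj₁

    hi≤lo : ∀ {a} → ¬ Favours a → hi a ≤ lo a
    hi≤lo ¬f = ≮⇒≥ λ lo<hi → ¬f (strict⇒favours lo<hi)

    closed₁ : ∀ {i j} → Matched (μ x) i j →
      (Favours (inj₁ i) → Favours (inj₂ j)) × (Favours (inj₂ j) → Favours (inj₁ i))
    closed₁ m = favours-forward (matched⇒edge₁ m) , favours-backward₁ m

    closed₂ : ∀ {i j} → Matched (μ y) i j →
      (Favours (inj₁ i) → Favours (inj₂ j)) × (Favours (inj₂ j) → Favours (inj₁ i))
    closed₂ m = favours-backward₂ m , favours-forward (matched⇒edge₂ m)

    module J = Splice (stable⇒settled sx) (stable⇒settled sy) Favours closed₁ closed₂
    module M = Splice (stable⇒settled sy) (stable⇒settled sx) Favours closed₂ closed₁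

    unblockedˣ : ∀ {z} i j → u x i ≤ u z i → v x j ≤ v z j → Unblocked 0# z i j
    unblockedˣ {z} i j u≤ v≤ = Unblocked-mono {x} {z} ≤-refl u≤ v≤ (proj₂ (stable⇒almostStable ≤-refl sx) i j)

    unblockedʸ : ∀ {z} i j → u y i ≤ u z i → v y j ≤ v z j → Unblocked 0# z i j
    unblockedʸ {z} i j u≤ v≤ = Unblocked-mono {y} {z} ≤-refl u≤ v≤ (proj₂ (stable⇒almostStable ≤-refl sy) i j)

    u≤J : ∀ i → u x i ≤ u J.outcome i × u y i ≤ u J.outcome i
    u≤J i = J.u-cases (λ t → u x i ≤ t × u y i ≤ t) i (λ f → ≤-refl , lo≤hi f) (λ ¬f → hi≤lo ¬f , ≤-refl)

    J≤v : ∀ j → v J.outcome j ≤ v x j × v J.outcome j ≤ v y j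
    J≤v j = J.v-cases (λ t → t ≤ v x j × t ≤ v y j) j (λ f → ≤-refl , lo≤hi f) (λ ¬f → hi≤lo ¬f , ≤-refl)

    M≤u : ∀ i → u M.outcome i ≤ u x i × u M.outcome i ≤ u y i
    M≤u i = M.u-cases (λ t → t ≤ u x i × t ≤ u y i) i (λ f → lo≤hi f , ≤-refl) (λ ¬f → ≤-refl , hi≤lo ¬f)

    v≤M : ∀ j → v x j ≤ v M.outcome j × v y j ≤ v M.outcome j
    v≤M j = M.v-cases (λ t → v x j ≤ t × v y j ≤ t) j (λ f → lo≤hi f , ≤-refl) (λ ¬f → ≤-refl , hi≤lo ¬f)

    -- A pair is unblocked in the outcome from which `v` of the join is taken at `j`, and there `u`
    -- is no larger than in the join. The meet exchanges the roles of `u` and `v`.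
    join : StableOutcomes
    join = J.outcome , almostStable⇒stable (J.settled , λ i j → unblocked i j
        (J.v-cases (λ t → v x j ≤ t ⊎ v y j ≤ t) j (λ _ → inj₁ ≤-refl) (λ _ → inj₂ ≤-refl)))
      where
      unblocked : ∀ i j → v x j ≤ v J.outcome j ⊎ v y j ≤ v J.outcome j → Unblocked 0# J.outcome i j
      unblocked i j (inj₁ v≤) = unblockedˣ {J.outcome} i j (proj₁ (u≤J i)) v≤
      unblocked i j (inj₂ v≤) = unblockedʸ {J.outcome} i j (proj₂ (u≤J i)) v≤

    meet : StableOutcomes
    meet = M.outcome , almostStable⇒stable (M.settled , λ i j → unblocked i j
        (M.u-cases (λ t → u x i ≤ t ⊎ u y i ≤ t) i (λ _ → inj₂ ≤-refl) (λ _ → inj₁ ≤-refl)))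
      where
      unblocked : ∀ i j → u x i ≤ u M.outcome i ⊎ u y i ≤ u M.outcome i → Unblocked 0# M.outcome i j
      unblocked i j (inj₁ u≤) = unblockedˣ {M.outcome} i j u≤ (proj₁ (v≤M j))
      unblocked i j (inj₂ u≤) = unblockedʸ {M.outcome} i j u≤ (proj₂ (v≤M j))

  joins : HasJoins (_≤ˢ_ G)
  joins x y = join
    , ((λ i → proj₁ (u≤J i)) , (λ j → proj₁ (J≤v j)))
    , ((λ i → proj₂ (u≤J i)) , (λ j → proj₂ (J≤v j)))
    , λ b (xu , xv) (yu , yv) →
        (λ i → J.u-cases (_≤ u (proj₁ b) i) i (λ _ → xu i) (λ _ → yu i))
      , (λ j → J.v-cases (v (proj₁ b) j ≤_) j (λ _ → xv j) (λ _ → yv j))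
    where open Binary x y using (join; u≤J; J≤v; module J)

  meets : HasJoins (flip (_≤ˢ_ G))
  meets x y = meet
    , ((λ i → proj₁ (M≤u i)) , (λ j → proj₁ (v≤M j)))
    , ((λ i → proj₂ (M≤u i)) , (λ j → proj₂ (v≤M j)))
    , λ b (xu , xv) (yu , yv) →
        (λ i → M.u-cases (u (proj₁ b) i ≤_) i (λ _ → yu i) (λ _ → xu i))
      , (λ j → M.v-cases (_≤ v (proj₁ b) j) j (λ _ → yv j) (λ _ → xv j))
    where open Binary x y using (meet; M≤u; v≤M; module M)

  -- Closedness of the order in each argument separately, so that `swap` gives the same for the
  -- opposite order.
  Closed : Rel (Outcome G) 0ℓ → Set
  Closed _⊑_ = ∀ {x t} →
      ((∀ {ε} → 0# < ε → ∃[ y ] (Near G ε x y × t ⊑ y)) → t ⊑ x)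
    × ((∀ {ε} → 0# < ε → ∃[ y ] (Near G ε x y × y ⊑ t)) → x ⊑ t)

  ≥ᴾ-closed : Closed (flip (_≥ᴾ_ G))
  ≥ᴾ-closed {x} {t} = below , above
    where
    below : (∀ {ε} → 0# < ε → ∃[ y ] (Near G ε x y × _≥ᴾ_ G y t)) → _≥ᴾ_ G x t
    below h = (λ i → limit-≤ λ 0<ε → atP i (h 0<ε)) , (λ j → limit-≥ λ 0<ε → atQ j (h 0<ε))
      where
      atP : ∀ i {ε} → ∃[ y ] (Near G ε x y × _≥ᴾ_ G y t) → ∃[ b ] (Close ε (u x i) b × u t i ≤ b)
      atP i (y , (nu , _) , (tu , _)) = u y i , nu i , tu i
      atQ : ∀ j {ε} → ∃[ y ] (Near G ε x y × _≥ᴾ_ G y t) → ∃[ b ] (Close ε (v x j) b × b ≤ v t j)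
      atQ j (y , (_ , nv , _) , (_ , tv)) = v y j , nv j , tv j
    above : (∀ {ε} → 0# < ε → ∃[ y ] (Near G ε x y × _≥ᴾ_ G t y)) → _≥ᴾ_ G t x
    above h = (λ i → limit-≥ λ 0<ε → atP i (h 0<ε)) , (λ j → limit-≤ λ 0<ε → atQ j (h 0<ε))
      where
      atP : ∀ i {ε} → ∃[ y ] (Near G ε x y × _≥ᴾ_ G t y) → ∃[ b ] (Close ε (u x i) b × b ≤ u t i)
      atP i (y , (nu , _) , (tu , _)) = u y i , nu i , tu i
      atQ : ∀ j {ε} → ∃[ y ] (Near G ε x y × _≥ᴾ_ G t y) → ∃[ b ] (Close ε (v x j) b × v t j ≤ b)
      atQ j (y , (_ , nv , _) , (_ , tv)) = v y j , nv j , tv j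

  -- The supremum of S is a cluster point of the directed set T of stable
  -- outcomes below all upper bounds of S.

  module _ {_⊑_ : Rel (Outcome G) 0ℓ} (⊑-refl : ∀ {x} → x ⊑ x)
           (⊑-trans : ∀ {x y z} → x ⊑ y → y ⊑ z → x ⊑ z) (closed : Closed _⊑_) where

    private
      _⊑ˢ_ : Rel StableOutcomes 0ℓ
      x ⊑ˢ y = proj₁ x ⊑ proj₁ y

    supremum : HasJoins _⊑ˢ_ → (S : Pred StableOutcomes 0ℓ) → Satisfiable S → ∃[ s ] IsSup _⊑ˢ_ S s
    supremum hasJoins S (s₀ , s₀∈S) = (x , x-stable) , x-upper , x-least
      where
      T : Pred StableOutcomes 0ℓ
      T t = ∀ b → IsUpperBound _⊑ˢ_ S b → t ⊑ˢ b

      S⊆T : ∀ s → S s → T s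
      S⊆T s s∈S b ub = ub s s∈S

      -- Small sets are those that the directed set `T`, read as a net, eventually avoids. Joins
      -- provide the later index for a union.
      bounded-away : Ideal (Outcome G)
      bounded-away .Small A = ∃[ t ] (T t × (∀ x → T x → A (proj₁ x) → ¬ t ⊑ˢ x))
      bounded-away .⊆-small A⊆B (t , t∈T , away) = t , t∈T , λ x x∈T a → away x x∈T (A⊆B a)
      bounded-away .∅-small = s₀ , S⊆T s₀ s₀∈S , λ _ _ ()
      bounded-away .∪-small (t , t∈T , awayA) (t′ , t′∈T , awayB) =
        let z , t⊑z , t′⊑z , least = hasJoins t t′ in
        z , (λ b ub → least b (t∈T b ub) (t′∈T b ub)) , λ where
          x x∈T (inj₁ a) z⊑x → awayA x x∈T a (⊑-trans t⊑z z⊑x)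
          x x∈T (inj₂ b) z⊑x → awayB x x∈T b (⊑-trans t′⊑z z⊑x)

      large : ¬ Small bounded-away Bounded
      large (t , t∈T , away) = away t t∈T (settled⇒bounded (stable⇒settled (proj₂ t))) ⊑-refl

      cluster = clusterPoint bounded-compact bounded-away large
      x = proj₁ cluster

      approached : ∀ {ε} → 0# < ε → ∀ t → T t → ∃[ y ] (T y × Near G ε x (proj₁ y) × t ⊑ˢ y)
      approached {ε} 0<ε t t∈T = decidable-stable em λ none → proj₂ cluster ε 0<ε
        (t , t∈T , λ y y∈T near t⊑y → none (y , y∈T , near , t⊑y))

      x-stable : Stable G x
      x-stable = stable-closed λ 0<ε → at 0<ε (approached 0<ε s₀ (S⊆T s₀ s₀∈S))
        where
        at : ∀ {ε} → 0# < ε → ∃[ y ] (T y × Near G ε x (proj₁ y) × s₀ ⊑ˢ y) →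
             ∃[ y ] (Near G ε x y × AlmostStable ε y)
        at 0<ε ((y , sy) , _ , near , _) = y , near , stable⇒almostStable (proj₁ 0<ε) sy

      x-upper : IsUpperBound _⊑ˢ_ S (x , x-stable)
      x-upper s s∈S = proj₁ closed λ 0<ε → at (approached 0<ε s (S⊆T s s∈S))
        where
        at : ∀ {ε} → ∃[ y ] (T y × Near G ε x (proj₁ y) × s ⊑ˢ y) → ∃[ y ] (Near G ε x y × proj₁ s ⊑ y)
        at ((y , _) , _ , near , s⊑y) = y , near , s⊑y

      x-least : ∀ b → IsUpperBound _⊑ˢ_ S b → (x , x-stable) ⊑ˢ b
      x-least b ub = proj₂ closed λ 0<ε → at (approached 0<ε s₀ (S⊆T s₀ s₀∈S))
        where
        at : ∀ {ε} → ∃[ y ] (T y × Near G ε x (proj₁ y) × s₀ ⊑ˢ y) → ∃[ y ] (Near G ε x y × y ⊑ proj₁ b)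
        at ((y , _) , y∈T , near , _) = y , near , y∈T b ub

  ≥ᴾ-refl : ∀ {x} → _≥ᴾ_ G x x
  ≥ᴾ-refl = (λ _ → ≤-refl) , (λ _ → ≤-refl)

  ≥ᴾ-trans : ∀ {x y z} → _≥ᴾ_ G x y → _≥ᴾ_ G y z → _≥ᴾ_ G x z
  ≥ᴾ-trans (xu , xv) (yu , yv) = (λ i → ≤-trans (yu i) (xu i)) , (λ j → ≤-trans (xv j) (yv j))

  everything : Pred StableOutcomes 0ℓ
  everything _ = ⊤

  nonempty-sup : (S : Pred StableOutcomes 0ℓ) → Satisfiable S → ∃[ s ] IsSup (_≤ˢ_ G) S s
  nonempty-sup = supremum (λ {x} → ≥ᴾ-refl {x}) (λ {x} {y} {z} p q → ≥ᴾ-trans {z} {y} {x} q p)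
    (λ {x} {t} → ≥ᴾ-closed {x} {t}) joins

  nonempty-inf : (S : Pred StableOutcomes 0ℓ) → Satisfiable S → ∃[ s ] IsInf (_≤ˢ_ G) S s
  nonempty-inf = supremum (λ {x} → ≥ᴾ-refl {x}) (λ {x} {y} {z} → ≥ᴾ-trans {x} {y} {z})
    (λ {x} {t} → swap (≥ᴾ-closed {x} {t})) meets

  greatest : ∃[ x ] Maximum (_≤ˢ_ G) x
  greatest = let x , ub , _ = nonempty-sup everything (stable-exists , _) in x , λ y → ub y _

  least : ∃[ x ] Minimum (_≤ˢ_ G) x
  least = let x , lb , _ = nonempty-inf everything (stable-exists , _) in x , λ y → lb y _

  all-sup : (S : Pred StableOutcomes 0ℓ) → ∃[ s ] IsSup (_≤ˢ_ G) S s
  all-sup S with em {Satisfiable S}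
  ... | yes inhabited = nonempty-sup S inhabited
  -- Every stable outcome bounds the empty set, so its supremum is the least one.
  ... | no empty      = proj₁ least , (λ x x∈S → contradiction (x , x∈S) empty) , λ b _ → proj₂ least b

  all-inf : (S : Pred StableOutcomes 0ℓ) → ∃[ s ] IsInf (_≤ˢ_ G) S s
  all-inf S with em {Satisfiable S}
  ... | yes inhabited = nonempty-inf S inhabited
  ... | no empty      = proj₁ greatest , (λ x x∈S → contradiction (x , x∈S) empty) , λ b _ → proj₂ greatest b

  -- Equality also concerns the matchings: equal payoffs mean that every gain is 0, and `coincide`
  -- then gives equal partners.
  ≤ˢ-antisym : ∀ {x y} → _≤ˢ_ G x y → _≤ˢ_ G y x → _≈ˢ_ G x y
  ≤ˢ-antisym {x , sx} {y , sy} (xu≤yu , yv≤xv) (yu≤xu , xv≤yv) = u≈ , v≈ , λ i →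
      Comparison.coincide em G nd sx sy (inj₁ i) (λ {b} _ → equal b)
    where
    u≈ : ∀ i → u x i ≈ u y i
    u≈ i = antisym (xu≤yu i) (yu≤xu i)
    v≈ : ∀ j → v x j ≈ v y j
    v≈ j = antisym (xv≤yv j) (yv≤xv j)
    equal : ∀ b → Comparison.lo em G nd sx sy b ≈ Comparison.hi em G nd sx sy b
    equal (inj₁ i) = sym (u≈ i)
    equal (inj₂ j) = v≈ j

  ≤ˢ-isPartialOrder : IsPartialOrder (_≈ˢ_ G) (_≤ˢ_ G)
  ≤ˢ-isPartialOrder = record
    { isPreorder = record
      { isEquivalence = record
        { refl  = (λ _ → refl) , (λ _ → refl) , (λ _ → ≡.refl)
        ; sym   = λ (p , q , m) → sym ∘ p , sym ∘ q , ≡.sym ∘ m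
        ; trans = λ (p , q , m) (p′ , q′ , m′) →
            (λ i → trans (p i) (p′ i)) , (λ j → trans (q j) (q′ j)) , (λ i → ≡.trans (m i) (m′ i))
        }
      ; reflexive = λ (p , q , _) → ≤-reflexive ∘ p , ≤-reflexive ∘ sym ∘ q
      ; trans     = λ {x} {y} {z} p q → ≥ᴾ-trans {proj₁ z} {proj₁ y} {proj₁ x} q p
      }
    ; antisym = λ {x} {y} → ≤ˢ-antisym {x} {y}
    }

  isCompleteLattice : IsCompleteLattice (_≈ˢ_ G) (_≤ˢ_ G)
  isCompleteLattice = record { isPartialOrder = ≤ˢ-isPartialOrder ; sup = all-sup ; inf = all-inf }

  unique-greatest : ∃[ x ] (Maximum (_≤ˢ_ G) x × (∀ y → Maximum (_≤ˢ_ G) y → _≈ˢ_ G y x))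
  unique-greatest = let x , max = greatest in
    x , max , λ y max′ → ≤ˢ-antisym {y} {x} (max y) (max′ x)

  unique-least : ∃[ x ] (Minimum (_≤ˢ_ G) x × (∀ y → Minimum (_≤ˢ_ G) y → _≈ˢ_ G y x))
  unique-least = let x , min = least in
    x , min , λ y min′ → ≤ˢ-antisym {y} {x} (min′ x) (min y)

theorem3 : ExcludedMiddle 0ℓ →
    (R : RealField) (n : ℕ) (G : RiFleGame R n) → NonDegenerate G →
    IsCompleteLattice (_≈ˢ_ G) (_≤ˢ_ G)
    × Compact G (Stable G)
    × (∃[ x ] (Maximum (_≤ˢ_ G) x × (∀ y → Maximum (_≤ˢ_ G) y → _≈ˢ_ G y x)))
    × (∃[ x ] (Minimum (_≤ˢ_ G) x × (∀ y → Minimum (_≤ˢ_ G) y → _≈ˢ_ G y x)))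
theorem3 em R n G nd =
  isCompleteLattice , StableSpace.stable-compact em G , unique-greatest , unique-least
  where open Lattice em G nd
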